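{- Let $G$ be a graph that is well-separable with respect to a set $\mathcal P$ of robust principal $(k+1)$-profiles of $G$, where $k=\kappa(\mathcal P,G)$. Then $G$ has a tree-decomposition $(T,\mathcal V)$ such that (1) $(T,\mathcal V)$ distinguishes any two $k$-distinguishable robust profiles in $\mathcal P$; (2) $(T,\mathcal V)$ is canonical with respect to $\mathcal P$; (3) $(T,\mathcal V)$ is $k$-balanced.
   Context: A separation of a graph $G$ is an ordered pair $(A,B)$ of subsets of $V(G)$ with $A\cup B=V(G)$ and no edge between $A\setminus B$ and $B\setminus A$; its order is $|A\cap B|$. $(A,B)\le(C,D)$ means $A\subseteq C$, $D\subseteq B$. A profile is a set $P$ of separations with (P1) if $(C,D)\le(A,B)\in P$ then $(D,C)\notin P$, and (P2) if $(A,B),(C,D)\in P$ then $(B\cap D,A\cup C)\notin P$. $P$ is principal if for every family $((A_i,B_i))_{i\in I}$ in $P$ with all $A_i\cap B_i$ equal, $\bigcap_i(B_i\setminus A_i)\neq\emptyset$; it is an $\ell$-profile if all its separations have order $<\ell$ and for each separation $(A,B)$ of order $<\ell$, $(A,B)\in P$ or $(B,A)\in P$; robust if for every $(A,B)\in P$ and every separation $(C,D)$ of finite order, if $(B\cap C,A\cup D)$, $(B\cap D,A\cup C)$ both have order $<|A\cap B|$ then one of them is not in $P$. A separation distinguishes $P,P'$ if it lies in one and its reverse in the other; $P,P'$ are $k$-distinguishable if some separation of order at most $k$ distinguishes them. $\kappa(\mathcal P,G)$ is the minimum order of a separation distinguishing two members of $\mathcal P$. $\mathcal R(k,\mathcal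 P,G)$ is the set of separations of finite order at most $k$ distinguishing two members of $\mathcal P$. A component $C$ of $G-(A\cap B)$ is degenerated if $N(C)\subsetneq A\cap B$; $G$ is well-separable w.r.t. $\mathcal P$ if no $(A,B)\in\mathcal R(\kappa(\mathcal P,G),\mathcal P,G)$ has a degenerated component of $G-(A\cap B)$. For a tree-decomposition $(T,(V_s))$, an edge $e$ induces $(\bigcup_{s\in T_1}V_s,\bigcup_{s\in T_2}V_s)$ and its reverse ($T_1,T_2$ the components of $T-e$); the tree-decomposition distinguishes two profiles if some separation induced by an edge distinguishes them; it is $k$-balanced if all adhesion sets $V_s\cap V_{s'}$ ($ss'\in E(T)$) have size exactly $k$. It is canonical w.r.t. $\mathcal P$ if its construction commutes with isomorphisms: whenever $\varphi:G\to G'$ is an isomorphism mapping $\mathcal P$ onto $\mathcal P'$, $\varphi$ maps the tree-decomposition for $(G,\mathcal P)$ onto that for $(G',\mathcal P')$. -}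

module Defs where

open import Data.Empty using (⊥)
open import Data.Fin.Base using (Fin; zero; suc; inject₁; fromℕ)
open import Data.Nat.Base using (ℕ; _+_; _≤_; _<_)
open import Data.Product.Base using (Σ-syntax; ∃; ∃-syntax; _×_; _,_; proj₁; proj₂)
open import Data.Sum.Base using (_⊎_; inj₁; inj₂; swap)
open import Function.Bundles using (Bijection; Inverse; _⇔_)
open import Level using (Level; _⊔_) renaming (suc to lsuc)
open import Relation.Binary.Bundles using (Setoid)
open import Relation.Binary.Construct.Closure.ReflexiveTransitive using (Star)
import Relation.Binary.Construct.On as On
import Relation.Binary.Construct.Union as Union
open import Relation.Binary.Core using (Rel)
open import Relation.Binary.Definitions
  using (Symmetric; Irreflexive; _Respects_; _Respects₂_)
open import Relation.Binary.PropositionalEquality.Core using (_≡_)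
import Relation.Binary.PropositionalEquality.Properties as ≡
open import Relation.Nullary.Negation.Core using (¬_)
open import Relation.Unary
  using (Pred; _∈_; _∉_; _⊆_; _⊂_; _≐_; _∩_; _∪_; _∖_; ⋂; Satisfiable; Universal)

private
  variable
    ℓ ℓ₁ ℓ₂ p q r t : Level

-- Vertices form a setoid so that a quotient, such as the node set of a tree
-- built from separations up to extensional equality, is again a vertex set.

record Graph ℓ : Set (lsuc ℓ) where
  infix 4 _~_
  field
    vertices : Setoid ℓ ℓ
  open Setoid vertices public using (_≈_) renaming (Carrier to V)
  field
    _~_      : Rel V ℓ
    ~-resp-≈ : _~_ Respects₂ _≈_
    ~-sym    : Symmetric _~_
    ~-irrefl : Irreflexive _≈_ _~_

-- X has exactly n elements, counted up to the equality of the setoid.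

HasSize : (S : Setoid ℓ₁ ℓ₂) → Pred (Setoid.Carrier S) p → ℕ → Set _
HasSize S X n = Bijection (≡.setoid (Fin n)) (On.setoid S (proj₁ {B = X}))

module _ (G : Graph ℓ) where
  open Graph G

  -- Joined R u v: there is a walk from u to v all of whose steps are in R.
  Joined : Rel V r → Rel V (ℓ ⊔ r)
  Joined R = Star (Union._∪_ _≈_ R)

  AvoidingVertices : Pred V p → Rel V (ℓ ⊔ p)
  AvoidingVertices X u v = u ~ v × u ∉ X × v ∉ X

  AvoidingEdge : V → V → Rel V ℓ
  AvoidingEdge s t u v = u ~ v × ¬ (u ≈ s × v ≈ t) × ¬ (u ≈ t × v ≈ s)

  -- C is (the vertex set of) a component of G - X.
  IsComponentOutside : Pred V p → Pred V q → Set _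
  IsComponentOutside X C = ∃[ v ] v ∉ X × C ≐ Joined (AvoidingVertices X) v

  N : Pred V p → Pred V (ℓ ⊔ p)
  N C v = v ∉ C × ∃[ u ] u ∈ C × u ~ v

  record IsPath {n} (f : Fin (ℕ.suc n) → V) : Set ℓ where
    field
      step     : ∀ i → f (inject₁ i) ~ f (suc i)
      distinct : ∀ {i j} → f i ≈ f j → i ≡ j

  IsCycle : ∀ {n} → (Fin (3 + n) → V) → Set ℓ
  IsCycle {n} f = IsPath f × f (fromℕ (2 + n)) ~ f zero

  record IsTree : Set ℓ where
    field
      node      : V
      connected : ∀ u v → Joined _~_ u v
      acyclic   : ∀ {n} (f : Fin (3 + n) → V) → ¬ IsCycle f

record Separation (G : Graph ℓ) : Set (lsuc ℓ) where
  open Graph G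
  field
    A B    : Pred V ℓ
    A-resp : A Respects _≈_
    B-resp : B Respects _≈_
    cover  : Universal (A ∪ B)
    noEdge : ∀ {u v} → u ∈ A ∖ B → v ∈ B ∖ A → ¬ (u ~ v)

module _ {G : Graph ℓ} where
  open Graph G
  open Separation

  infix  4 _≤ˢ_ _≋_
  infix  8 _⁻
  infixr 7 _⊓_

  _≤ˢ_ : Rel (Separation G) ℓ
  S ≤ˢ T = A S ⊆ A T × B T ⊆ B S

  _≋_ : Rel (Separation G) ℓ
  S ≋ T = A S ≐ A T × B S ≐ B T

  _⁻ : Separation G → Separation G
  S ⁻ = record
    { A      = B S
    ; B      = A S
    ; A-resp = B-resp S
    ; B-resp = A-resp S
    ; cover  = λ v → swap (cover S v)
    ; noEdge = λ u∈B∖A v∈A∖B u~v → noEdge S v∈A∖B u∈B∖A (~-sym u~v)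
    }

  -- The corner (B ∩ D , A ∪ C) of (A , B) and (C , D) is S ⁻ ⊓ T ⁻.
  _⊓_ : Separation G → Separation G → Separation G
  S ⊓ T = record
    { A      = A S ∩ A T
    ; B      = B S ∪ B T
    ; A-resp = λ { u≈v (a , c) → A-resp S u≈v a , A-resp T u≈v c }
    ; B-resp = λ { u≈v (inj₁ b) → inj₁ (B-resp S u≈v b)
                 ; u≈v (inj₂ d) → inj₂ (B-resp T u≈v d) }
    ; cover  = λ v → cover′ (cover S v) (cover T v)
    ; noEdge = λ { ((a , c) , ∉B∪D) (_ , ∉A∩C) u~v →
        let v∉A∖ = λ v∈B v∉A → noEdge S (a , λ b → ∉B∪D (inj₁ b)) (v∈B , v∉A) u~v
            v∉C∖ = λ v∈D v∉C → noEdge T (c , λ d → ∉B∪D (inj₂ d)) (v∈D , v∉C) u~v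
        in corner ∉A∩C (cover S _) (cover T _) v∉A∖ v∉C∖ }
    }
    where
    cover′ : ∀ {v} → v ∈ A S ∪ B S → v ∈ A T ∪ B T →
             v ∈ (A S ∩ A T) ∪ (B S ∪ B T)
    cover′ (inj₁ a) (inj₁ c) = inj₁ (a , c)
    cover′ (inj₁ _) (inj₂ d) = inj₂ (inj₂ d)
    cover′ (inj₂ b) _        = inj₂ (inj₁ b)

    corner : ∀ {v} → v ∉ A S ∩ A T → v ∈ A S ∪ B S → v ∈ A T ∪ B T →
             (v ∈ B S → ¬ (v ∉ A S)) → (v ∈ B T → ¬ (v ∉ A T)) → ⊥
    corner ∉A∩C (inj₁ a) (inj₁ c) _ _ = ∉A∩C (a , c)
    corner ∉A∩C (inj₁ a) (inj₂ d) _ k = k d λ c → ∉A∩C (a , c)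
    corner ∉A∩C (inj₂ b) (inj₁ c) h _ = h b λ a → ∉A∩C (a , c)
    corner ∉A∩C (inj₂ b) (inj₂ d) h k = h b λ a → k d λ c → ∉A∩C (a , c)

  separator : Separation G → Pred V ℓ
  separator S = A S ∩ B S

  HasOrder : Separation G → ℕ → Set ℓ
  HasOrder S = HasSize vertices (separator S)

  FiniteOrder : Separation G → Set ℓ
  FiniteOrder S = ∃[ n ] HasOrder S n

  OrderAtMost : ℕ → Separation G → Set ℓ
  OrderAtMost n S = ∃[ m ] m ≤ n × HasOrder S m

  OrderBelow : ℕ → Separation G → Set ℓ
  OrderBelow n S = ∃[ m ] m < n × HasOrder S m

  -- Comparison of orders as elements of ℕ ∪ {∞}.
  OrderLess : Separation G → Separation G → Set ℓ
  OrderLess S T = ∃[ m ] HasOrder S m × ¬ OrderAtMost m T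

record Profile (G : Graph ℓ) : Set (lsuc ℓ) where
  field
    member : Pred (Separation G) ℓ
    resp   : member Respects _≋_
    P1     : ∀ {S T} → T ≤ˢ S → S ∈ member → T ⁻ ∉ member
    P2     : ∀ {S T} → S ∈ member → T ∈ member → S ⁻ ⊓ T ⁻ ∉ member

module _ {G : Graph ℓ} where
  open Graph G
  open Separation
  open Profile

  infix 4 _∈ᵖ_
  _∈ᵖ_ : Separation G → Profile G → Set ℓ
  S ∈ᵖ P = S ∈ member P

  -- A family indexed by a larger type gives nothing new: for each vertex
  -- missing from the intersection, keep one member witnessing this.
  IsPrincipal : Profile G → Set (lsuc ℓ)
  IsPrincipal P = ∀ (I : Set ℓ) (S : I → Separation G) →
    (∀ i → S i ∈ᵖ P) → (∀ i j → separator (S i) ≐ separator (S j)) →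
    Satisfiable (⋂ I (λ i → B (S i) ∖ A (S i)))

  record _IsProfileOfOrder_ (P : Profile G) (l : ℕ) : Set (lsuc ℓ) where
    field
      below : ∀ S → S ∈ᵖ P → OrderBelow l S
      total : ∀ S → OrderBelow l S → S ∈ᵖ P ⊎ S ⁻ ∈ᵖ P

  IsRobust : Profile G → Set (lsuc ℓ)
  IsRobust P = ∀ S T → S ∈ᵖ P → FiniteOrder T →
    OrderLess (S ⁻ ⊓ T) S → OrderLess (S ⁻ ⊓ T ⁻) S →
    ¬ (S ⁻ ⊓ T ∈ᵖ P × S ⁻ ⊓ T ⁻ ∈ᵖ P)

  Distinguishes : Separation G → Profile G → Profile G → Set ℓ
  Distinguishes S P P′ = (S ∈ᵖ P × S ⁻ ∈ᵖ P′) ⊎ (S ⁻ ∈ᵖ P × S ∈ᵖ P′)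

  Distinguishable : ℕ → Profile G → Profile G → Set (lsuc ℓ)
  Distinguishable k P P′ = ∃[ S ] OrderAtMost k S × Distinguishes S P P′

  DistinguishesSomeIn : Pred (Profile G) p → Pred (Separation G) (lsuc ℓ ⊔ p)
  DistinguishesSomeIn 𝒫 S =
    ∃[ P ] ∃[ P′ ] P ∈ 𝒫 × P′ ∈ 𝒫 × Distinguishes S P P′

  -- k = κ(𝒫 , G); in particular the minimum exists and is finite.
  record Isκ (𝒫 : Pred (Profile G) p) (k : ℕ) : Set (lsuc ℓ ⊔ p) where
    field
      attained : ∃[ S ] HasOrder S k × S ∈ DistinguishesSomeIn 𝒫
      minimal  : ∀ {S n} → S ∈ DistinguishesSomeIn 𝒫 → HasOrder S n → k ≤ n

  ℛ : ℕ → Pred (Profile G) p → Pred (Separation G) (lsuc ℓ ⊔ p)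
  ℛ k 𝒫 S = OrderAtMost k S × S ∈ DistinguishesSomeIn 𝒫

  WellSeparable : Pred (Profile G) p → Set (lsuc ℓ ⊔ p)
  WellSeparable 𝒫 = ∀ {k} → Isκ 𝒫 k → ∀ {S} → S ∈ ℛ k 𝒫 →
    ∀ (C : Pred V ℓ) → IsComponentOutside G (separator S) C →
    ¬ (N G C ⊂ separator S)

record TreeDecomposition (G : Graph ℓ) t : Set (ℓ ⊔ lsuc t) where
  private module G = Graph G
  field
    T         : Graph t
    isTree    : IsTree T
  private module T = Graph T
  field
    part      : T.V → Pred G.V t
    node-resp : ∀ {s s′} → s T.≈ s′ → part s ≐ part s′
    part-resp : ∀ s → part s Respects G._≈_
    vertices  : ∀ v → ∃[ s ] v ∈ part s
    edges     : ∀ {u v} → u G.~ v → ∃[ s ] u ∈ part s × v ∈ part s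
    paths     : ∀ {n} (f : Fin (ℕ.suc n) → T.V) → IsPath T f →
                ∀ i → part (f zero) ∩ part (f (fromℕ n)) ⊆ part (f i)

module _ {G : Graph ℓ} (𝒯 : TreeDecomposition G t) where
  open TreeDecomposition 𝒯
  open Graph T

  -- The union of the parts in the component of T - st that contains s.
  Side : V → V → Pred (Graph.V G) t
  Side s t v = ∃[ x ] Joined T (AvoidingEdge T s t) s x × v ∈ part x

  -- The edge st induces S; its reverse is induced by ts.
  Induces : V → V → Separation G → Set _
  Induces s t S = s ~ t × Separation.A S ≐ Side s t × Separation.B S ≐ Side t s

  TDDistinguishes : Profile G → Profile G → Set _
  TDDistinguishes P P′ = ∃[ s ] ∃[ t ] ∃[ S ] Induces s t S × Distinguishes S P P′

  IsBalanced : ℕ → Set _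
  IsBalanced k = ∀ {s t} → s ~ t → HasSize (Graph.vertices G) (part s ∩ part t) k

record _≅_ (G : Graph ℓ₁) (H : Graph ℓ₂) : Set (ℓ₁ ⊔ ℓ₂) where
  private
    module G = Graph G
    module H = Graph H
  field
    inverse : Inverse G.vertices H.vertices
  open Inverse inverse public using (to; from)
  field
    adjacent : ∀ {u v} → u G.~ v ⇔ to u H.~ to v

module _ {G : Graph ℓ₁} {H : Graph ℓ₂} (φ : G ≅ H) where
  open _≅_ φ

  -- φ[ X ] = Y
  MapsSet : Pred (Graph.V G) p → Pred (Graph.V H) q → Set _
  MapsSet X Y = ∀ v → v ∈ X ⇔ to v ∈ Y

  MapsSeparation : Separation G → Separation H → Set _
  MapsSeparation S S′ = MapsSet (Separation.A S) (Separation.A S′)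
                      × MapsSet (Separation.B S) (Separation.B S′)

  MapsProfile : Profile G → Profile H → Set _
  MapsProfile P P′ = ∀ {S S′} → MapsSeparation S S′ → S ∈ᵖ P ⇔ S′ ∈ᵖ P′

  MapsOnto : Pred (Profile G) p → Pred (Profile H) q → Set _
  MapsOnto 𝒫 𝒫′ = (∀ {P}  → P  ∈ 𝒫  → ∃[ P′ ] P′ ∈ 𝒫′ × MapsProfile P P′)
                × (∀ {P′} → P′ ∈ 𝒫′ → ∃[ P  ] P  ∈ 𝒫  × MapsProfile P P′)

-- The action on trees is only determined up to renaming of the nodes.

MapsTD : {G : Graph ℓ₁} {H : Graph ℓ₂} → G ≅ H →
         TreeDecomposition G t → TreeDecomposition H r → Set _
MapsTD φ 𝒯 𝒯′ =
  Σ[ ψ ∈ 𝒯.T ≅ 𝒯′.T ] (∀ s → MapsSet φ (𝒯.part s) (𝒯′.part (_≅_.to ψ s)))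
  where
  module 𝒯  = TreeDecomposition 𝒯
  module 𝒯′ = TreeDecomposition 𝒯′

record Admissible (G : Graph ℓ) (𝒫 : Pred (Profile G) p) (k : ℕ)
       : Set (lsuc ℓ ⊔ p) where
  field
    k≡κ           : Isκ 𝒫 k
    robust        : ∀ {P} → P ∈ 𝒫 → IsRobust P
    principal     : ∀ {P} → P ∈ 𝒫 → IsPrincipal P
    isProfile     : ∀ {P} → P ∈ 𝒫 → P IsProfileOfOrder (ℕ.suc k)
    wellSeparable : WellSeparable 𝒫

-- Canonicity is a property of a construction, not of a single
-- tree-decomposition.

Construction : (ℓ p t : Level) → Set _
Construction ℓ p t =
  ∀ (G : Graph ℓ) (𝒫 : Pred (Profile G) p) k → Admissible G 𝒫 k →
  TreeDecomposition G t

IsCanonical : Construction ℓ p t → Set _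
IsCanonical {ℓ = ℓ} {p = p} 𝒯 =
  ∀ (G  : Graph ℓ) (𝒫  : Pred (Profile G)  p) k  (adm  : Admissible G  𝒫  k)
    (G′ : Graph ℓ) (𝒫′ : Pred (Profile G′) p) k′ (adm′ : Admissible G′ 𝒫′ k′)
    (φ : G ≅ G′) → MapsOnto φ 𝒫 𝒫′ →
  MapsTD φ (𝒯 G 𝒫 k adm) (𝒯 G′ 𝒫′ k′ adm′)

{-# OPTIONS --safe #-}

-- Since k = κ, the separators X of size k that separate two members of 𝒫 have, by well-separability, only
-- components of G - X attached to all of X; call such sets tight. By principality every member of 𝒫 lives
-- in one component of G - X. Two tight sets are nested if neither separates the other, which is a symmetric
-- relation, and a finite set is separated by only finitely many tight sets of size k. So each X has a
-- finite crossing number, and 𝒩 collects, for all pairs in 𝒫, the separators of the pair with least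
-- crossing number. If two of them crossed, then two profiles living in different components for both would
-- give two opposite corners, again of size k by submodularity and minimality of k, and with a smaller sum of
-- crossing numbers; suitable corners separate the original pairs, a contradiction. Hence 𝒩 is nested.
-- The tree has a hub for each X ∈ 𝒩, whose part is X, and for each component C of G - X a block next to X on
-- the side of C. Blocks are identified when every Y ∈ 𝒩 sees them in the same component of G - Y. An edge
-- from the hub X to a block then induces the separation (V ∖ C , C ∪ X), which has order k.
module Submission where

open import Axiom.ExcludedMiddle using (ExcludedMiddle)
open import Data.Bool.Base using (Bool; true; false)
open import Data.Empty using (⊥)
open import Data.Fin.Base using (Fin; zero; suc; inject₁; fromℕ; toℕ)
open import Data.Fin.Induction using (<-weakInduction; >-weakInduction)
open import Data.Fin.Properties using (injective⇒≤; toℕ-inject₁)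
open import Data.List.Base using (List; []; _∷_; _++_; length; lookup; tabulate) renaming (map to mapList)
import Data.List.Membership.Setoid as ListMembership
import Data.List.Membership.Setoid.Properties as ListMembershipₚ
open import Data.List.Properties using (length-++; length-map; length-tabulate)
open import Data.List.Relation.Unary.Any using (Any; here; there; index) renaming (map to mapAny)
open import Data.List.Relation.Unary.Any.Properties using (lookup-index; ++⁺ˡ; ++⁺ʳ) renaming (map⁺ to Any-map⁺)
open import Data.Nat.Base using (ℕ; zero; suc; _+_; _≤_; _<_; z≤n; s≤s)
open import Data.Nat.Induction using (<-wellFounded)
open import Data.Nat.Properties
  using (≤-refl; ≤-reflexive; ≤-trans; ≤-antisym; ≤-<-trans; <-asym; <⇒≱; ≰⇒>; 1+n≰n; m≤n⇒m≤1+n; m≢1+n+m; +-suc;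
         +-mono-≤; +-monoˡ-≤; +-monoʳ-≤; +-cancelˡ-≤; +-cancelʳ-≤; +-cancelˡ-<; +-cancelʳ-<)
open import Data.Nat.Tactic.RingSolver using (solve-∀)
open import Data.Product.Base using (Σ-syntax; ∃; ∃-syntax; ∃₂; _×_; _,_; proj₁; proj₂; swap)
open import Data.Sum.Base using (_⊎_; inj₁; inj₂) renaming (map to map⊎)
open import Data.Unit.Base using (⊤; tt)
open import Function.Base using (_∘_; id)
open import Function.Bundles using (Bijection; Inverse; Equivalence; mk⇔)
import Function.Construct.Symmetry as Symmetry
open import Induction.WellFounded using (Acc; acc)
open import Level using (Level; Lift; lift) renaming (suc to lsuc)
open import Relation.Binary.Bundles using (Setoid)
open import Relation.Binary.Construct.Closure.ReflexiveTransitive using (ε; _◅_; _◅◅_; reverse; gmap)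
  renaming (map to mapStar)
open import Relation.Binary.Definitions using (_Respects_)
open import Relation.Binary.PropositionalEquality.Core using (_≡_; _≢_; refl; sym; trans; cong; subst)
open import Relation.Nullary.Decidable.Core using (Dec; yes; no; decidable-stable)
open import Relation.Nullary.Negation.Core using (¬_; contradiction)
open import Relation.Unary using (Pred; _∈_; _∉_; _⊆_; _≐_; _∩_; _∪_; _∖_; ∁)
open import Relation.Unary.Relation.Binary.Equality using (≐-setoid)
open import Defs

-- Counting elements of a setoid: covering lists, submodularity, exact sizes

module Counting (em : ∀ {a} → ExcludedMiddle a) {a r} (S : Setoid a r) where
  open Setoid S using (Carrier; _≈_)
  private module ≈ = Setoid S
  open ListMembership S using () renaming (_∈_ to _∈ₗ_)

  Covers : ∀ {p} → List Carrier → Pred Carrier p → Set _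
  Covers xs X = ∀ {x} → x ∈ X → x ∈ₗ xs

  -- A bound is a list that meets every element. Repetitions and foreign entries are allowed, so
  -- bounds pass to subsets unchanged and no bijection has to be chosen.
  AtMost : ∀ {p} → ℕ → Pred Carrier p → Set _
  AtMost n X = ∃[ xs ] length xs ≤ n × Covers xs X

  Without : ∀ {p} → Pred Carrier p → Carrier → Pred Carrier _
  Without X z x = x ∈ X × ¬ x ≈ z

  atMost-⊆ : ∀ {p q n} {X : Pred Carrier p} {Y : Pred Carrier q} → X ⊆ Y → AtMost n Y → AtMost n X
  atMost-⊆ X⊆Y (xs , len , cov) = xs , len , cov ∘ X⊆Y

  without-list : ∀ xs {z} → z ∈ₗ xs → ∃[ ys ] length xs ≡ suc (length ys) ×
    (∀ {x} → x ∈ₗ xs → ¬ x ≈ z → x ∈ₗ ys)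
  without-list (x ∷ xs) {z} (here z≈x) = xs , refl , rest
    where
    rest : ∀ {y} → y ∈ₗ (x ∷ xs) → ¬ y ≈ z → y ∈ₗ xs
    rest (here y≈x) y≉z = contradiction (≈.trans y≈x (≈.sym z≈x)) y≉z
    rest (there y∈) _   = y∈
  without-list (x ∷ xs) {z} (there z∈xs) with ys , len , rest ← without-list xs z∈xs =
    x ∷ ys , cong suc len , rest′
    where
    rest′ : ∀ {y} → y ∈ₗ (x ∷ xs) → ¬ y ≈ z → y ∈ₗ (x ∷ ys)
    rest′ (here y≈x) _  = here y≈x
    rest′ (there y∈) y≉z = there (rest y∈ y≉z)

  atMost-without : ∀ {p n} {X : Pred Carrier p} {z} → AtMost n X → z ∈ X →
    ∃[ m ] n ≡ suc m × AtMost m (Without X z)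
  atMost-without (xs , len , cov) z∈X with without-list xs (cov z∈X)
  ... | ys , eq , rest with subst (_≤ _) eq len
  ...   | s≤s len′ = _ , refl , ys , len′ , λ (x∈X , x≉z) → rest (cov x∈X) x≉z

  -- Disjointness sends each entry to at most one of the two lists, so no length is gained. `K` and
  -- `L` must respect `_≈_` because an entry represents elements only up to `_≈_`.
  split : ∀ {p q} {K : Pred Carrier p} {L : Pred Carrier q} → K Respects _≈_ → L Respects _≈_ →
    (∀ {x} → x ∈ K → x ∉ L) → ∀ xs → ∃₂ λ ys zs → length ys + length zs ≤ length xs ×
    (∀ {x} → x ∈ₗ xs → x ∈ K → x ∈ₗ ys) × (∀ {x} → x ∈ₗ xs → x ∈ L → x ∈ₗ zs)
  split K-resp L-resp disj [] = [] , [] , z≤n , (λ ()) , λ ()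
  split {K = K} {L} K-resp L-resp disj (x ∷ xs)
    with ys , zs , len , inK , inL ← split K-resp L-resp disj xs | em {P = x ∈ K} | em {P = x ∈ L}
  ... | yes x∈K | _ = x ∷ ys , zs , s≤s len , inK′ , inL′
    where
    inK′ : ∀ {y} → y ∈ₗ (x ∷ xs) → y ∈ K → y ∈ₗ (x ∷ ys)
    inK′ (here y≈x) _   = here y≈x
    inK′ (there y∈) y∈K = there (inK y∈ y∈K)
    inL′ : ∀ {y} → y ∈ₗ (x ∷ xs) → y ∈ L → y ∈ₗ zs
    inL′ (here y≈x) y∈L = contradiction (L-resp y≈x y∈L) (disj x∈K)
    inL′ (there y∈) y∈L = inL y∈ y∈L
  ... | no x∉K | yes x∈L = ys , x ∷ zs , ≤-trans (≤-reflexive (+-suc _ _)) (s≤s len) , inK′ , inL′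
    where
    inK′ : ∀ {y} → y ∈ₗ (x ∷ xs) → y ∈ K → y ∈ₗ ys
    inK′ (here y≈x) y∈K = contradiction (K-resp y≈x y∈K) x∉K
    inK′ (there y∈) y∈K = inK y∈ y∈K
    inL′ : ∀ {y} → y ∈ₗ (x ∷ xs) → y ∈ L → y ∈ₗ (x ∷ zs)
    inL′ (here y≈x) _   = here y≈x
    inL′ (there y∈) y∈L = there (inL y∈ y∈L)
  ... | no x∉K | no x∉L = ys , zs , m≤n⇒m≤1+n len , inK′ , inL′
    where
    inK′ : ∀ {y} → y ∈ₗ (x ∷ xs) → y ∈ K → y ∈ₗ ys
    inK′ (here y≈x) y∈K = contradiction (K-resp y≈x y∈K) x∉K
    inK′ (there y∈) y∈K = inK y∈ y∈K
    inL′ : ∀ {y} → y ∈ₗ (x ∷ xs) → y ∈ L → y ∈ₗ zs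
    inL′ (here y≈x) y∈L = contradiction (L-resp y≈x y∈L) x∉L
    inL′ (there y∈) y∈L = inL y∈ y∈L

  module _ {p q p′ q′} {X : Pred Carrier p} {Y : Pred Carrier q}
    {K : Pred Carrier p′} {L : Pred Carrier q′}
    (X-resp : X Respects _≈_) (K-resp : K Respects _≈_) (L-resp : L Respects _≈_) where

    -- An element of `K ∩ L` lies in `X` and in `Y`, so it can be charged to `xs` for `K` and to
    -- `ys` for `L`. Any other element of `K` or `L` is charged to `xs` if it lies in `X`, and to
    -- `ys` otherwise. No entry is charged twice, which is the disjointness that `split` asks for.
    submodular : ∀ {m n} → K ⊆ X ∪ Y → L ⊆ X ∪ Y → K ∩ L ⊆ X ∩ Y → AtMost m X → AtMost n Y →
      ∃₂ λ i j → i + j ≤ m + n × AtMost i K × AtMost j L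
    submodular {m} {n} K⊆ L⊆ K∩L⊆ (xs , lenX , covX) (ys , lenY , covY)
      with ks , ls , len , inK , inL ← split {K = K} {L = L ∖ K} K-resp
             (λ x≈y (x∈L , x∉K) → L-resp x≈y x∈L , λ y∈K → x∉K (K-resp (≈.sym x≈y) y∈K))
             (λ x∈K (_ , x∉K) → x∉K x∈K) xs
         | ks′ , ls′ , len′ , inK′ , inL′ ← split {K = K ∖ X} {L = λ x → x ∈ L × (x ∈ K ⊎ x ∉ X)}
             (λ x≈y (x∈K , x∉X) → K-resp x≈y x∈K , λ y∈X → x∉X (X-resp (≈.sym x≈y) y∈X))
             (λ { x≈y (x∈L , inj₁ x∈K) → L-resp x≈y x∈L , inj₁ (K-resp x≈y x∈K)
                ; x≈y (x∈L , inj₂ x∉X) → L-resp x≈y x∈L , inj₂ λ y∈X → x∉X (X-resp (≈.sym x≈y) y∈X) })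
             (λ { (x∈K , x∉X) (x∈L , _) → x∉X (proj₁ (K∩L⊆ (x∈K , x∈L))) }) ys
      = length (ks ++ ks′) , length (ls ++ ls′) , bound , (ks ++ ks′ , ≤-refl , covK) , ls ++ ls′ , ≤-refl , covL
      where
      arrange : ∀ a b c d → (a + b) + (c + d) ≡ (a + c) + (b + d)
      arrange = solve-∀
      bound : length (ks ++ ks′) + length (ls ++ ls′) ≤ m + n
      bound rewrite length-++ ks {ks′} | length-++ ls {ls′}
                  | arrange (length ks) (length ks′) (length ls) (length ls′) =
        +-mono-≤ (≤-trans len lenX) (≤-trans len′ lenY)
      covK : Covers (ks ++ ks′) K
      covK {x} x∈K with em {P = x ∈ X} | K⊆ x∈K
      ... | yes x∈X | _        = ++⁺ˡ (inK (covX x∈X) x∈K)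
      ... | no  x∉X | inj₁ x∈X = contradiction x∈X x∉X
      ... | no  x∉X | inj₂ x∈Y = ++⁺ʳ ks (inK′ (covY x∈Y) (x∈K , x∉X))
      covL : Covers (ls ++ ls′) L
      covL {x} x∈L with em {P = x ∈ K} | em {P = x ∈ X} | L⊆ x∈L
      ... | yes x∈K | _       | _ = ++⁺ʳ ls (inL′ (covY (proj₂ (K∩L⊆ (x∈K , x∈L)))) (x∈L , inj₁ x∈K))
      ... | no  x∉K | yes x∈X | _ = ++⁺ˡ (inL (covX x∈X) (x∈L , x∉K))
      ... | no  x∉K | no  x∉X | inj₁ x∈X = contradiction x∈X x∉X
      ... | no  x∉K | no  x∉X | inj₂ x∈Y = ++⁺ʳ ls (inL′ (covY x∈Y) (x∈L , inj₂ x∉X))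

  module _ {p q p′ q′} {X : Pred Carrier p} {Y : Pred Carrier q}
    {K : Pred Carrier p′} {L : Pred Carrier q′}
    (X-resp : X Respects _≈_) (K-resp : K Respects _≈_) (L-resp : L Respects _≈_) where

    -- Since `z` is in neither `K` nor `L`, it can be deleted from `Y` before `submodular` is
    -- applied, which lowers the bound for `Y` by one.
    submodular-strict : ∀ {m n z} → K ⊆ X ∪ Y → L ⊆ X ∪ Y → K ∩ L ⊆ X ∩ Y → AtMost m X → AtMost n Y →
      z ∈ Y → z ∉ K → z ∉ L → ∃₂ λ i j → i + j < m + n × AtMost i K × AtMost j L
    submodular-strict {m} {n} {z} K⊆ L⊆ K∩L⊆ atX atY z∈Y z∉K z∉L = strict (atMost-without atY z∈Y)
      where
      avoid : ∀ {p} {M : Pred Carrier p} {x} → M Respects _≈_ → z ∉ M → x ∈ M →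
              x ∈ X ∪ Y → x ∈ X ∪ Without Y z
      avoid M-resp z∉M x∈M (inj₁ x∈X) = inj₁ x∈X
      avoid M-resp z∉M x∈M (inj₂ x∈Y) = inj₂ (x∈Y , λ x≈z → z∉M (M-resp x≈z x∈M))
      strict : (∃[ n₀ ] n ≡ suc n₀ × AtMost n₀ (Without Y z)) →
               ∃₂ λ i j → i + j < m + n × AtMost i K × AtMost j L
      strict (n₀ , refl , atY′)
        with i , j , le , atK , atL ← submodular X-resp K-resp L-resp
               (λ x∈K → avoid K-resp z∉K x∈K (K⊆ x∈K)) (λ x∈L → avoid L-resp z∉L x∈L (L⊆ x∈L))
               (λ (x∈K , x∈L) → let x∈X , x∈Y = K∩L⊆ (x∈K , x∈L) in
                  x∈X , x∈Y , λ x≈z → z∉K (K-resp x≈z x∈K)) atX atY′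
        = i , j , ≤-trans (s≤s le) (≤-reflexive (sym (+-suc m n₀))) , atK , atL

  hasSize⇒atMost : ∀ {p n} {X : Pred Carrier p} → HasSize S X n → AtMost n X
  hasSize⇒atMost {X = X} size =
    tabulate (proj₁ ∘ to) , ≤-reflexive (length-tabulate (proj₁ ∘ to)) , covers
    where
    open Bijection size using (to; strictlySurjective)
    covers : Covers (tabulate (proj₁ ∘ to)) X
    covers {x} x∈X with i , fi≈x ← strictlySurjective (x , x∈X) =
      ListMembershipₚ.∈-resp-≈ S fi≈x (ListMembershipₚ.∈-tabulate⁺ S i)

  -- Pigeonhole: sending each element to its position in the list is injective.
  size≤ : ∀ {p k n} {X : Pred Carrier p} → HasSize S X k → AtMost n X → k ≤ n
  size≤ {X = X} size (xs , len , cov) = ≤-trans (injective⇒≤ position-injective) len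
    where
    open Bijection size using (to; injective)
    position : ∀ i → proj₁ (to i) ∈ₗ xs
    position i = cov (proj₂ (to i))
    position-injective : ∀ {i j} → index (position i) ≡ index (position j) → i ≡ j
    position-injective {i} {j} eq = injective (≈.trans (lookup-index (position i))
      (≈.trans (≈.reflexive (cong (lookup xs) eq)) (≈.sym (lookup-index (position j)))))

  hasSize-≐ : ∀ {p q k} {X : Pred Carrier p} {Y : Pred Carrier q} → X ≐ Y → HasSize S X k → HasSize S Y k
  hasSize-≐ (X⊆Y , Y⊆X) size = record
    { to = λ i → proj₁ (to i) , X⊆Y (proj₂ (to i))
    ; cong = cong′
    ; bijective = injective , λ (y , y∈Y) → let i , f = surjective (y , Y⊆X y∈Y) in i , f
    }
    where open Bijection size using (to; injective; surjective) renaming (cong to cong′)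

  module _ {p m} {X : Pred Carrier p} {z} (z∈X : z ∈ X) (size : HasSize S (Without X z) m) where
    open Bijection size using (to; injective; strictlySurjective)

    private
      extended : Fin (suc m) → ∃ X
      extended zero    = z , z∈X
      extended (suc i) = proj₁ (to i) , proj₁ (proj₂ (to i))

      extended-injective : ∀ {i j} → proj₁ (extended i) ≈ proj₁ (extended j) → i ≡ j
      extended-injective {zero}  {zero}  _  = refl
      extended-injective {zero}  {suc j} eq = contradiction (≈.sym eq) (proj₂ (proj₂ (to j)))
      extended-injective {suc i} {zero}  eq = contradiction eq (proj₂ (proj₂ (to i)))
      extended-injective {suc i} {suc j} eq = cong suc (injective eq)

      extended-surjective : ∀ y → y ∈ X → ∃[ i ] (∀ {j} → j ≡ i → proj₁ (extended j) ≈ y)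
      extended-surjective y y∈X with em {P = y ≈ z}
      ... | yes y≈z = zero , λ { refl → ≈.sym y≈z }
      ... | no  y≉z with i , eq ← strictlySurjective (y , y∈X , y≉z) = suc i , λ { refl → eq }

    hasSize-suc : HasSize S X (suc m)
    hasSize-suc = record
      { to = extended
      ; cong = λ { refl → ≈.refl }
      ; bijective = extended-injective , λ (y , y∈X) → extended-surjective y y∈X
      }

  -- An entry that represents some `z` of `X` is removed together with `z`, so later copies of the
  -- entry no longer match anything and are dropped.
  covers⇒hasSize : ∀ {p} {X : Pred Carrier p} xs → Covers xs X → ∃[ m ] m ≤ length xs × HasSize S X m
  covers⇒hasSize [] cov = 0 , z≤n , record
    { to = λ ()
    ; cong = λ { {()} }
    ; bijective = (λ { {()} }) , λ (x , x∈X) → contradiction (cov x∈X) λ ()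
    }
  covers⇒hasSize {X = X} (x ∷ xs) cov = extend em
    where
    drop : ∀ {p} {Y : Pred Carrier p} → Y ⊆ X → (∀ {y} → y ∈ Y → ¬ y ≈ x) → Covers xs Y
    drop Y⊆X Y≉x y∈Y with cov (Y⊆X y∈Y)
    ... | here y≈x = contradiction y≈x (Y≉x y∈Y)
    ... | there y∈ = y∈
    extend : Dec (∃[ z ] z ∈ X × z ≈ x) → ∃[ m ] m ≤ suc (length xs) × HasSize S X m
    extend (no none) =
      let m , m≤ , size = covers⇒hasSize xs (drop (λ y∈X → y∈X) λ y∈X y≈x → none (_ , y∈X , y≈x))
      in m , m≤n⇒m≤1+n m≤ , size
    extend (yes (z , z∈X , z≈x)) =
      let m , m≤ , size = covers⇒hasSize {X = Without X z} xs
            (drop {Y = Without X z} proj₁ λ (_ , y≉z) y≈x → y≉z (≈.trans y≈x (≈.sym z≈x)))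
      in suc m , s≤s m≤ , hasSize-suc z∈X size

  atMost⇒hasSize : ∀ {p n} {X : Pred Carrier p} → AtMost n X → ∃[ m ] m ≤ n × HasSize S X m
  atMost⇒hasSize (xs , len , cov) =
    let m , m≤ , size = covers⇒hasSize xs cov in m , ≤-trans m≤ len , size

  -- A missing `y` would leave `X` inside `Y` without `y`, a set with fewer than `k` elements.
  equal-size : ∀ {p k} {X Y : Pred Carrier p} → X Respects _≈_ →
    HasSize S X k → HasSize S Y k → X ⊆ Y → Y ⊆ X
  equal-size {X = X} X-resp sizeX sizeY X⊆Y {y} y∈Y with em {P = y ∈ X}
  ... | yes y∈X = y∈X
  ... | no  y∉X with k , refl , atY ← atMost-without (hasSize⇒atMost sizeY) y∈Y =
    contradiction (size≤ sizeX (atMost-⊆ (λ x∈X → X⊆Y x∈X , λ x≈y → y∉X (X-resp x≈y x∈X)) atY)) 1+n≰n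

  Finite : ∀ {p} → Pred Carrier p → Set _
  Finite X = ∃[ n ] AtMost n X

  finite-⊆ : ∀ {p q} {X : Pred Carrier p} {Y : Pred Carrier q} → X ⊆ Y → Finite Y → Finite X
  finite-⊆ X⊆Y (n , atY) = n , atMost-⊆ X⊆Y atY

  finite-∅ : ∀ {p} {X : Pred Carrier p} → (∀ {x} → x ∉ X) → Finite X
  finite-∅ empty = 0 , [] , z≤n , λ x∈X → contradiction x∈X empty

  finite-singleton : ∀ z → Finite (_≈ z)
  finite-singleton z = 1 , z ∷ [] , ≤-refl , here

  finite-∪ : ∀ {p q} {X : Pred Carrier p} {Y : Pred Carrier q} → Finite X → Finite Y → Finite (X ∪ Y)
  finite-∪ (_ , xs , _ , covX) (_ , ys , _ , covY) = _ , xs ++ ys , ≤-refl ,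
    λ { (inj₁ x∈X) → ++⁺ˡ (covX x∈X) ; (inj₂ x∈Y) → ++⁺ʳ xs (covY x∈Y) }

-- Connectivity outside a vertex set, tight sets and nestedness

module Separators (em : ∀ {a} → ExcludedMiddle a) {ℓ} (G : Graph ℓ) where
  open Graph G
  private module V = Setoid vertices
  private module CV = Counting em vertices
  private module CS = Counting em (≐-setoid V ℓ)

  Conn : Pred V ℓ → V → V → Set ℓ
  Conn X = Joined G (AvoidingVertices G X)

  conn-≈ : ∀ {X u v} → u ≈ v → Conn X u v
  conn-≈ u≈v = inj₁ u≈v ◅ ε

  conn-sym : ∀ {X u v} → Conn X u v → Conn X v u
  conn-sym = reverse λ
    { (inj₁ u≈v) → inj₁ (V.sym u≈v)
    ; (inj₂ (u~v , u∉X , v∉X)) → inj₂ (~-sym u~v , v∉X , u∉X) }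

  conn-antitone : ∀ {X Y u v} → Y ⊆ X → Conn X u v → Conn Y u v
  conn-antitone Y⊆X = mapStar λ
    { (inj₁ u≈v) → inj₁ u≈v
    ; (inj₂ (u~v , u∉X , v∉X)) → inj₂ (u~v , u∉X ∘ Y⊆X , v∉X ∘ Y⊆X) }

  conn-outside : ∀ {X u v} → X Respects _≈_ → u ∉ X → Conn X u v → v ∉ X
  conn-outside resp u∉X ε = u∉X
  conn-outside resp u∉X (inj₁ u≈w ◅ c) = conn-outside resp (u∉X ∘ resp (V.sym u≈w)) c
  conn-outside resp u∉X (inj₂ (_ , _ , w∉X) ◅ c) = conn-outside resp w∉X c

  -- A walk in `G - X` never leaves the component of its start, so it is also a walk in `G - Y` if
  -- that component avoids `Y`.
  transfer : ∀ {X Y u v} → (∀ {w} → Conn X u w → w ∉ Y) → Conn X u v → Conn Y u v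
  transfer avoid ε = ε
  transfer avoid (inj₁ u≈w ◅ c) = inj₁ u≈w ◅ transfer (avoid ∘ (inj₁ u≈w ◅_)) c
  transfer avoid (inj₂ e ◅ c) =
    inj₂ (proj₁ e , avoid ε , avoid (inj₂ e ◅ ε)) ◅ transfer (avoid ∘ (inj₂ e ◅_)) c

  -- The common size turns inclusions between tight sets into equalities. `split` provides a second
  -- component of `G - X`, which is what makes nestedness symmetric.
  record Tight (k : ℕ) (X : Pred V ℓ) : Set ℓ where
    field
      resp  : X Respects _≈_
      size  : HasSize vertices X k
      full  : ∀ {v x} → v ∉ X → x ∈ X → ∃[ u ] Conn X v u × u ~ x
      split : ∃₂ λ u v → u ∉ X × v ∉ X × ¬ Conn X u v

    outside : ∀ {u v} → u ∉ X → Conn X u v → v ∉ X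
    outside = conn-outside resp

  open Tight

  attach : ∀ {k X Y v a} → Tight k X → v ∉ X → (∀ {w} → Conn X v w → w ∉ Y) →
    a ∉ Y → a ∈ X ⊎ Conn X v a → Conn Y v a
  attach tX v∉X avoid a∉Y (inj₂ c) = transfer avoid c
  attach tX v∉X avoid a∉Y (inj₁ a∈X) with u , c , u~a ← full tX v∉X a∈X =
    transfer avoid c ◅◅ inj₂ (u~a , avoid c , a∉Y) ◅ ε

  -- This holds vacuously if `Z` contains one of the two sets, so its failure provides a vertex of
  -- each outside `Z`, lying in different components.
  Together : (Z X Y : Pred V ℓ) → Set ℓ
  Together Z X Y = ∀ {x y} → x ∈ X → x ∉ Z → y ∈ Y → y ∉ Z → Conn Z x y

  Nested : (X Z : Pred V ℓ) → Set ℓ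
  Nested X Z = Together Z X X

  together-sym : ∀ {Z X Y} → Together Z X Y → Together Z Y X
  together-sym t y∈Y y∉Z x∈X x∉Z = conn-sym (t x∈X x∉Z y∈Y y∉Z)

  apart-sym : ∀ {Z X Y} → ¬ Together Z X Y → ¬ Together Z Y X
  apart-sym {Z} {X} {Y} ¬t t = ¬t (together-sym {Z} {Y} {X} t)

  apart : ∀ {Z X Y} → ¬ Together Z X Y →
    ∃₂ λ x y → (x ∈ X × x ∉ Z) × (y ∈ Y × y ∉ Z) × ¬ Conn Z x y
  apart ¬t = decidable-stable em λ none → ¬t λ x∈X x∉Z y∈Y y∉Z →
    decidable-stable em λ ¬c → none (_ , _ , (x∈X , x∉Z) , (y∈Y , y∉Z) , ¬c)

  attached-together : ∀ {k X Y v} {U W : Pred V ℓ} → Tight k X → v ∉ X → (∀ {w} → Conn X v w → w ∉ Y) →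
    (∀ {w} → w ∈ U → w ∈ X ⊎ Conn X v w) → (∀ {w} → w ∈ W → w ∈ X ⊎ Conn X v w) → Together Y U W
  attached-together tX v∉X avoid U⊆ W⊆ x∈ x∉Y y∈ y∉Y =
    conn-sym (attach tX v∉X avoid x∉Y (U⊆ x∈)) ◅◅ attach tX v∉X avoid y∉Y (W⊆ y∈)

  -- If `Y` met both components, then `X` would separate two of its vertices.
  component-avoids : ∀ {k X Y u v} → Tight k X → Nested Y X → u ∉ X → v ∉ X → ¬ Conn X u v →
    (∀ {w} → Conn X u w → w ∉ Y) ⊎ (∀ {w} → Conn X v w → w ∉ Y)
  component-avoids {X = X} {Y} {u} {v} tX nested u∉X v∉X ¬uv with em {P = ∃[ w ] Conn X u w × w ∈ Y}
  ... | no none = inj₁ λ c w∈Y → none (_ , c , w∈Y)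
  ... | yes (w , uw , w∈Y) = inj₂ λ vz z∈Y →
    ¬uv (uw ◅◅ nested w∈Y (outside tX u∉X uw) z∈Y (outside tX v∉X vz) ◅◅ conn-sym vz)

  -- One of two components of `G - X` avoids `Y`, and all of `X` is attached to it, so deleting `Y`
  -- leaves the rest of `X` connected through that component.
  nested-sym : ∀ {k X Y} → Tight k X → Nested Y X → Nested X Y
  nested-sym tX nested with u , v , u∉X , v∉X , ¬uv ← split tX
    with component-avoids tX nested u∉X v∉X ¬uv
  ... | inj₁ avoid = attached-together tX u∉X avoid inj₁ inj₁
  ... | inj₂ avoid = attached-together tX v∉X avoid inj₁ inj₁

  component-beside : ∀ {k Z Y c y} → Tight k Z → Nested Y Z → y ∈ Y → y ∉ Z → c ∉ Z → ¬ Conn Z y c →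
    ∀ {w} → Conn Z c w → w ∉ Y
  component-beside tZ nested y∈Y y∉Z c∉Z ¬yc cw w∈Y =
    ¬yc (nested y∈Y y∉Z w∈Y (outside tZ c∉Z cw) ◅◅ conn-sym cw)

  -- If Z does not separate X from W, then both lie in Z ∪ C for one component C, and C avoids Y.
  separated-between : ∀ {k X Y Z W} → Tight k Z → Nested Y Z → Nested W Z →
    ¬ Together Y X W → ¬ Together Z Y W → ¬ Together Z X W
  separated-between {X = X} {Y} {Z} {W} tZ YZ WZ ¬XW ¬YW XW
    with y , w , (y∈Y , y∉Z) , (w∈W , w∉Z) , ¬yw ← apart ¬YW =
    ¬XW (attached-together tZ w∉Z (component-beside tZ YZ y∈Y y∉Z w∉Z ¬yw)
      (near λ x∈X x∉Z → conn-sym (XW x∈X x∉Z w∈W w∉Z)) (near (WZ w∈W w∉Z)))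
    where
    near : ∀ {U : Pred V ℓ} {w} → (∀ {u} → u ∈ U → u ∉ Z → Conn Z w u) →
           ∀ {u} → u ∈ U → u ∈ Z ⊎ Conn Z w u
    near conn {u} u∈U with em {P = u ∈ Z}
    ... | yes u∈Z = inj₁ u∈Z
    ... | no  u∉Z = inj₂ (conn u∈U u∉Z)

  -- If `Z` separated `X` from `Y` without separating either of them, then `X` would lie in `Z` and
  -- one component avoiding `Y`, and `Y` could not separate `X`. So what `Z` leaves of `X` and of
  -- `Y` is in one component.
  nested-∪ : ∀ {k X Y Z W} → Tight k Z → ¬ Nested X Y → Nested X Z → Nested Y Z → W ⊆ X ∪ Y → Nested W Z
  nested-∪ {X = X} {Y} {Z} tZ cross XZ YZ W⊆ x∈ x∉Z y∈ y∉Z = cases (W⊆ x∈) (W⊆ y∈)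
    where
    YX : Together Z Y X
    YX = decidable-stable em λ ¬YX → separated-between tZ YZ XZ cross ¬YX XZ
    cases : _ ∈ X ∪ Y → _ ∈ X ∪ Y → Conn Z _ _
    cases (inj₁ x∈X) (inj₁ y∈X) = XZ x∈X x∉Z y∈X y∉Z
    cases (inj₁ x∈X) (inj₂ y∈Y) = conn-sym (YX y∈Y y∉Z x∈X x∉Z)
    cases (inj₂ x∈Y) (inj₁ y∈X) = YX x∈Y x∉Z y∈X y∉Z
    cases (inj₂ x∈Y) (inj₂ y∈Y) = YZ x∈Y x∉Z y∈Y y∉Z

  -- Finitely many tight sets separate a finite set

  -- The state of the recursion in `separating-finite`: `W` collects vertices already known to be in
  -- `Z`, and `n` bounds those still to be found.
  Separating : (k n : ℕ) (W : Pred V ℓ) (u v : V) → Pred (Pred V ℓ) ℓ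
  Separating k n W u v Z = Tight k Z × W ⊆ Z × CV.AtMost n (Z ∖ W) × u ∉ Z × v ∉ Z × ¬ Conn Z u v

  -- Either u and v are joined outside W, and Z ∖ W meets the walk, or else Z = W because each vertex
  -- of Z ∖ W is adjacent to the components of both u and v.
  separating-finite : ∀ {k} n W u v → CS.Finite (Separating k n W u v)
  separating-finite n W u v with em {P = Conn W u v}
  separating-finite n W u v | no ¬uv =
    CS.finite-⊆ (λ (tZ , W⊆Z , _ , u∉Z , v∉Z , _) → Z⊆W tZ W⊆Z u∉Z v∉Z , W⊆Z) (CS.finite-singleton W)
    where
    Z⊆W : ∀ {k Z} → Tight k Z → W ⊆ Z → u ∉ Z → v ∉ Z → Z ⊆ W
    Z⊆W tZ W⊆Z u∉Z v∉Z z∈Z = decidable-stable em λ z∉W →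
      let a , ua , a~z = full tZ u∉Z z∈Z
          b , vb , b~z = full tZ v∉Z z∈Z
          a∉W = outside tZ u∉Z ua ∘ W⊆Z
          b∉W = outside tZ v∉Z vb ∘ W⊆Z
      in ¬uv (conn-antitone W⊆Z ua ◅◅ inj₂ (a~z , a∉W , z∉W) ◅ inj₂ (~-sym b~z , z∉W , b∉W) ◅
              conn-sym (conn-antitone W⊆Z vb))
  separating-finite zero W u v | yes uv = CS.finite-∅ λ (tZ , W⊆Z , (xs , len , cov) , u∉Z , v∉Z , ¬uv) →
    ¬uv (conn-antitone (λ z∈Z → decidable-stable em λ z∉W → empty len (cov (z∈Z , z∉W))) uv)
    where
    empty : ∀ {z xs} → length xs ≤ 0 → ¬ Any (z ≈_) xs
    empty {xs = []} z≤n ()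
  separating-finite {k} (suc n) W u v | yes uv =
    CS.finite-⊆ (λ hit@(_ , _ , _ , u∉Z , _ , ¬uv) → hit , u∉Z , ¬uv) (walk uv)
    where
    walk : ∀ {a b} → Conn W a b →
      CS.Finite λ Z → Separating k (suc n) W u v Z × a ∉ Z × ¬ Conn Z a b
    walk ε = CS.finite-∅ λ (_ , _ , ¬aa) → ¬aa ε
    walk (inj₁ a≈c ◅ cb) = CS.finite-⊆ (λ (hit , a∉Z , ¬ab) →
      hit , a∉Z ∘ resp (proj₁ hit) (V.sym a≈c) , ¬ab ∘ (inj₁ a≈c ◅_)) (walk cb)
    walk {a} {b} (_◅_ {j = c} (inj₂ (a~c , a∉W , c∉W)) cb) =
      CS.finite-⊆ cases (CS.finite-∪ (separating-finite n (λ x → x ∈ W ⊎ x ≈ c) u v) (walk cb))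
      where
      cases : ∀ {Z} → Separating k (suc n) W u v Z × a ∉ Z × ¬ Conn Z a b →
        Separating k n (λ x → x ∈ W ⊎ x ≈ c) u v Z ⊎ (Separating k (suc n) W u v Z × c ∉ Z × ¬ Conn Z c b)
      cases {Z} (hit@(tZ , W⊆Z , at , u∉Z , v∉Z , ¬uv) , a∉Z , ¬ab) with em {P = c ∈ Z}
      ... | no c∉Z = inj₂ (hit , c∉Z , ¬ab ∘ (inj₂ (a~c , a∉Z , c∉Z) ◅_))
      ... | yes c∈Z with _ , refl , at′ ← CV.atMost-without at (c∈Z , c∉W) =
        inj₁ (tZ , (λ { (inj₁ x∈W) → W⊆Z x∈W ; (inj₂ x≈c) → resp tZ (V.sym x≈c) c∈Z }) ,
              CV.atMost-⊆ (λ (z∈Z , z∉) → (z∈Z , z∉ ∘ inj₁) , z∉ ∘ inj₂) at′ , u∉Z , v∉Z , ¬uv)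

  -- There are finitely many pairs of a vertex of `X` and a vertex of `Y`, and each pair is
  -- separated by finitely many tight sets.
  apart-finite : ∀ {k X Y} → CV.Finite X → CV.Finite Y → CS.Finite λ Z → Tight k Z × ¬ Together Z X Y
  apart-finite {k} {X} {Y} (_ , xs , _ , covX) (_ , ys , _ , covY) =
    CS.finite-⊆ (λ (tZ , ¬t) → let x , y , (x∈X , x∉Z) , (y∈Y , y∉Z) , ¬xy = apart ¬t in
      tZ , x , y , covX x∈X , covY y∈Y , x∉Z , y∉Z , ¬xy) (left xs)
    where
    S : V → V → Pred (Pred V ℓ) ℓ
    S x y Z = x ∉ Z × y ∉ Z × ¬ Conn Z x y
    right : ∀ x ys → CS.Finite λ Z → Tight k Z × ∃[ y ] Any (y ≈_) ys × S x y Z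
    right x []       = CS.finite-∅ λ { (_ , _ , () , _) }
    right x (w ∷ ys) = CS.finite-⊆ (λ {
        (tZ , y , here y≈w , x∉Z , y∉Z , ¬xy) → inj₁ (tZ , (λ ()) , CV.atMost-⊆ proj₁ (CV.hasSize⇒atMost (size tZ)) ,
          x∉Z , y∉Z ∘ resp tZ (V.sym y≈w) , λ xw → ¬xy (xw ◅◅ conn-≈ (V.sym y≈w)))
      ; (tZ , y , there y∈ , s) → inj₂ (tZ , y , y∈ , s) })
      -- Nothing is prescribed at the start, so all `k` vertices of `Z` are still to be found.
      (CS.finite-∪ (separating-finite k (λ _ → Lift ℓ ⊥) x w) (right x ys))
    left : ∀ xs → CS.Finite λ Z → Tight k Z × ∃₂ λ x y → Any (x ≈_) xs × Any (y ≈_) ys × S x y Z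
    left []       = CS.finite-∅ λ { (_ , _ , _ , () , _) }
    left (w ∷ xs) = CS.finite-⊆ (λ {
        (tZ , x , y , here x≈w , y∈ , x∉Z , y∉Z , ¬xy) →
          inj₁ (tZ , y , y∈ , x∉Z ∘ resp tZ (V.sym x≈w) , y∉Z , λ wy → ¬xy (conn-≈ x≈w ◅◅ wy))
      ; (tZ , x , y , there x∈ , s) → inj₂ (tZ , x , y , x∈ , s) })
      (CS.finite-∪ (right w ys) (left xs))

-- Profiles, the components they live in, and the separators between them

module Profiles (em : ∀ {a} → ExcludedMiddle a) {ℓ} (G : Graph ℓ)
  (𝒫 : Pred (Profile G) (lsuc ℓ)) (k : ℕ) where
  open Graph G
  open Separators em G
  open Separation
  open Profile
  open Tight
  private module V = Setoid vertices
  private module CV = Counting em vertices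
  private module CS = Counting em (≐-setoid V ℓ)

  sep : Separation G → Pred V ℓ
  sep = separator {G = G}

  separator-resp : (S : Separation G) → sep S Respects _≈_
  separator-resp S x≈y (a , b) = A-resp S x≈y a , B-resp S x≈y b

  side-closed : ∀ S {X u w} → sep S ⊆ X → u ∈ B S ∖ A S → Conn X u w → w ∈ B S ∖ A S
  side-closed S S⊆X u∈ ε = u∈
  side-closed S S⊆X (u∈B , u∉A) (inj₁ u≈w ◅ c) =
    side-closed S S⊆X (B-resp S u≈w u∈B , λ w∈A → u∉A (A-resp S (V.sym u≈w) w∈A)) c
  side-closed S {u = u} S⊆X (u∈B , u∉A) (_◅_ {j = w} (inj₂ (u~w , _ , w∉X)) c) =
    side-closed S S⊆X (w∈B , w∉A) c
    where
    w∉A : w ∉ A S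
    w∉A w∈A = noEdge S (w∈A , λ w∈B → w∉X (S⊆X (w∈A , w∈B))) (u∈B , u∉A) (~-sym u~w)
    w∈B : w ∈ B S
    w∈B with cover S w
    ... | inj₁ w∈A = contradiction w∈A w∉A
    ... | inj₂ w∈B = w∈B

  module _ {X : Pred V ℓ} (X-resp : X Respects _≈_) {v : V} (v∉X : v ∉ X) where

    -- With `C` the component of `v`, this is the separation (V ∖ C , C ∪ X). The first side
    -- contains `X`, as no vertex of `X` can be reached from `v`.
    away : Separation G
    away = record
      { A      = λ w → ¬ Conn X v w
      ; B      = λ w → w ∈ X ⊎ Conn X v w
      ; A-resp = λ w≈z ¬vw vz → ¬vw (vz ◅◅ conn-≈ (V.sym w≈z))
      ; B-resp = λ { w≈z (inj₁ w∈X) → inj₁ (X-resp w≈z w∈X) ; w≈z (inj₂ vw) → inj₂ (vw ◅◅ conn-≈ w≈z) }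
      ; cover  = λ w → cover′ w em
      ; noEdge = λ (¬vu , u∉B) (w∈B , ¬¬vw) u~w → let vw = decidable-stable em ¬¬vw in
          ¬vu (vw ◅◅ inj₂ (~-sym u~w , conn-outside X-resp v∉X vw , λ u∈X → u∉B (inj₁ u∈X)) ◅ ε)
      }
      where
      cover′ : ∀ w → Dec (Conn X v w) → ¬ Conn X v w ⊎ (w ∈ X ⊎ Conn X v w)
      cover′ w (yes vw) = inj₂ (inj₂ vw)
      cover′ w (no ¬vw) = inj₁ ¬vw

    separator-away : sep away ≐ X
    separator-away = (λ { (_ , inj₁ w∈X) → w∈X ; (¬vw , inj₂ vw) → contradiction vw ¬vw })
                   , (λ w∈X → (λ vw → conn-outside X-resp v∉X vw w∈X) , inj₁ w∈X)

  -- Profiles point to the `B` sides, so the component of `v` is the one that `P` points to. A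
  -- component is represented by any of its vertices.
  record Lives (P : Profile G) (X : Pred V ℓ) (v : V) : Set (lsuc ℓ) where
    constructor _,_
    field
      ∉separator : v ∉ X
      big        : ∀ S → S ∈ᵖ P → sep S ≐ X → v ∈ B S ∖ A S

  open Lives

  -- The separation is kept only as a witness: nestedness and crossing numbers depend on its
  -- separator alone.
  record Sep (P P′ : Profile G) (X : Pred V ℓ) : Set (lsuc ℓ) where
    constructor sepBy
    field
      separation    : Separation G
      order         : HasOrder separation k
      separator≐    : sep separation ≐ X
      distinguishes : Distinguishes separation P P′

  𝒳 : Pred (Pred V ℓ) (lsuc ℓ)
  𝒳 X = ∃₂ λ P P′ → P ∈ 𝒫 × P′ ∈ 𝒫 × Sep P P′ X

  Crossing : Pred V ℓ → Pred (Pred V ℓ) (lsuc ℓ)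
  Crossing X Z = Z ∈ 𝒳 × ¬ Nested X Z

  -- Taking `X` itself for `Y` in the last clause shows that `n` is the exact number of sets
  -- crossing `X`, not just a bound.
  Optimal : Profile G → Profile G → Pred V ℓ → ℕ → Set (lsuc ℓ)
  Optimal P P′ X n = Sep P P′ X × CS.AtMost n (Crossing X) ×
    (∀ {Y m} → Sep P P′ Y → CS.AtMost m (Crossing Y) → n ≤ m)

  𝒩 : Pred (Pred V ℓ) (lsuc ℓ)
  𝒩 X = ∃₂ λ P P′ → P ∈ 𝒫 × P′ ∈ 𝒫 × ∃[ n ] Optimal P P′ X n

  sep-sym : ∀ {P P′ X} → Sep P P′ X → Sep P′ P X
  sep-sym (sepBy S order e (inj₁ (S∈P , S⁻∈P′))) = sepBy S order e (inj₂ (S⁻∈P′ , S∈P))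
  sep-sym (sepBy S order e (inj₂ (S⁻∈P , S∈P′))) = sepBy S order e (inj₁ (S∈P′ , S⁻∈P))

  sep-≐ : ∀ {P P′ X Y} → X ≐ Y → Sep P P′ X → Sep P P′ Y
  sep-≐ (X⊆Y , Y⊆X) (sepBy S order (S⊆X , X⊆S) dist) =
    sepBy S order ((λ x∈S → X⊆Y (S⊆X x∈S)) , λ y∈Y → X⊆S (Y⊆X y∈Y)) dist

  sep-resp : ∀ {P P′ X} → Sep P P′ X → X Respects _≈_
  sep-resp (sepBy S _ (S⊆X , X⊆S) _) x≈y x∈X = S⊆X (separator-resp S x≈y (X⊆S x∈X))

  optimal-sym : ∀ {P P′ X n} → Optimal P P′ X n → Optimal P′ P X n
  optimal-sym (s , at , least) = sep-sym s , at , λ s′ → least (sep-sym s′)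

  crossing-resp : ∀ X → Crossing X Respects _≐_
  crossing-resp X Z≐Y@(Z⊆Y , Y⊆Z) ((P , P′ , P∈ , P′∈ , s) , cross) =
    (P , P′ , P∈ , P′∈ , sep-≐ Z≐Y s) ,
    λ nested → cross λ x∈X x∉Z y∈X y∉Z →
      conn-antitone Z⊆Y (nested x∈X (λ x∈Y → x∉Z (Y⊆Z x∈Y)) y∈X (λ y∈Y → y∉Z (Y⊆Z y∈Y)))

  module _ (adm : Admissible G 𝒫 k) where
    open Admissible adm
    open Isκ k≡κ
    module Order {P} (P∈𝒫 : P ∈ 𝒫) = _IsProfileOfOrder_ (isProfile P∈𝒫)

    hasSize⇒below : ∀ S {X : Pred V ℓ} → sep S ≐ X → HasSize vertices X k → OrderBelow (suc k) S
    hasSize⇒below S (S⊆X , X⊆S) size = k , ≤-refl , CV.hasSize-≐ (X⊆S , S⊆X) size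

    -- Principality allows only families indexed by Set ℓ, so each vertex selects a separation of P which
    -- rules it out, if there is one.
    lives : ∀ {P X} → P ∈ 𝒫 → X Respects _≈_ → HasSize vertices X k → ∃[ v ] Lives P X v
    lives {P} {X} P∈𝒫 X-resp size =
      let v , v∈ = principal P∈𝒫 V (λ v → proj₁ (choice v em)) (λ v → proj₁ (proj₂ (choice v em)))
                     (λ u v → ≐-trans′ (sep-choice u em) (sep-choice v em))
      in v , chosen v em (v∈ v)
      where
      Avoids : V → Set (lsuc ℓ)
      Avoids v = ∃[ S ] S ∈ᵖ P × sep S ≐ X × v ∉ B S ∖ A S
      -- The default for a vertex that nothing rules out. The separation of `X` against all vertices
      -- has order `k`, so it or its reverse is in `P`. A vertex strictly on its big side is not in
      -- `X`.
      trivial : ∃[ S ] S ∈ᵖ P × sep S ≐ X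
      trivial with Order.total P∈𝒫 whole (hasSize⇒below whole (proj₁ , λ x∈X → x∈X , lift tt) size)
        where
        whole : Separation G
        whole = record
          { A = X ; B = λ _ → Lift ℓ ⊤ ; A-resp = X-resp ; B-resp = λ _ _ → lift tt
          ; cover = λ _ → inj₂ (lift tt) ; noEdge = λ (_ , u∉) _ _ → u∉ (lift tt) }
      ... | inj₁ S∈P  = _ , S∈P , proj₁ , λ x∈X → x∈X , lift tt
      ... | inj₂ S⁻∈P = _ , S⁻∈P , proj₂ , λ x∈X → lift tt , x∈X
      choice : ∀ v → Dec (Avoids v) → ∃[ S ] S ∈ᵖ P × sep S ≐ X
      choice v (yes (S , S∈P , e , _)) = S , S∈P , e
      choice v (no _)                    = trivial
      sep-choice : ∀ v d → sep (proj₁ (choice v d)) ≐ X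
      sep-choice v d = proj₂ (proj₂ (choice v d))
      ≐-trans′ : {S T : Pred V ℓ} → S ≐ X → T ≐ X → S ≐ T
      ≐-trans′ (S⊆X , X⊆S) (T⊆X , X⊆T) = (λ s → X⊆T (S⊆X s)) , λ t → X⊆S (T⊆X t)
      chosen : ∀ v d → v ∈ B (proj₁ (choice v d)) ∖ A (proj₁ (choice v d)) → Lives P X v
      chosen v (yes (_ , _ , _ , v∉)) v∈ = contradiction v∈ v∉
      chosen v (no none) (_ , v∉A) =
        (λ v∈X → v∉A (proj₁ (proj₂ (proj₂ (proj₂ trivial)) v∈X))) ,
        λ S S∈P sepS → decidable-stable em λ v∉ → none (S , S∈P , sepS , v∉)

    -- If the reverse were in `P`, then `v` would have to lie outside its own component.
    away∈ : ∀ {P X v} → P ∈ 𝒫 → (tX : Tight k X) (live : Lives P X v) → away (resp tX) (∉separator live) ∈ᵖ P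
    away∈ P∈𝒫 tX (v∉X , big)
      with Order.total P∈𝒫 (away (resp tX) v∉X)
             (hasSize⇒below (away (resp tX) v∉X) (separator-away (resp tX) v∉X) (size tX))
    ... | inj₁ in-P = in-P
    ... | inj₂ rev  = contradiction ε (proj₁ (big _ rev (let S⊆ , ⊆S = separator-away (resp tX) v∉X in
                        (λ (b , a) → S⊆ (a , b)) , λ x∈X → swap (⊆S x∈X))))

    away∉ : ∀ {P X u v} (tX : Tight k X) (u∉X : u ∉ X) → Lives P X v → ¬ Conn X u v →
      away (resp tX) u∉X ∉ member P
    away∉ tX u∉X (_ , big) ¬uv in-P = proj₂ (big _ in-P (separator-away (resp tX) u∉X)) ¬uv

    distinguish : ∀ {P P′ X v v′} → P ∈ 𝒫 → P′ ∈ 𝒫 → (tX : Tight k X) (live : Lives P X v) → Lives P′ X v′ →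
      ¬ Conn X v v′ → let S = away (resp tX) (∉separator live) in S ∈ᵖ P × S ⁻ ∈ᵖ P′
    distinguish P∈𝒫 P′∈𝒫 tX live live′ ¬vv′
      with Order.total P′∈𝒫 (away (resp tX) (∉separator live)) 
             (hasSize⇒below (away (resp tX) (∉separator live)) (separator-away (resp tX) (∉separator live)) (size tX))
    ... | inj₁ in-P′ = contradiction in-P′ (away∉ tX (∉separator live) live′ ¬vv′)
    ... | inj₂ rev   = away∈ P∈𝒫 tX live , rev

    -- The two profiles point to opposite strict sides of the separation, and no walk avoiding the
    -- separator changes sides.
    sep⇒apart : ∀ {P P′ X v v′} → Sep P P′ X → Lives P X v → Lives P′ X v′ → ¬ Conn X v v′
    sep⇒apart (sepBy S _ (S⊆X , X⊆S) (inj₁ (S∈P , S⁻∈P′))) (_ , big) (_ , big′) vv′ =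
      proj₂ (side-closed S S⊆X (big S S∈P (S⊆X , X⊆S)) vv′)
        (proj₁ (big′ (S ⁻) S⁻∈P′ ((λ (b , a) → S⊆X (a , b)) , λ x∈X → swap (X⊆S x∈X))))
    sep⇒apart {P} {P′} (sepBy S o e (inj₂ d)) live live′ vv′ =
      sep⇒apart (sepBy S o e (inj₁ (swap d))) live′ live (conn-sym vv′)

    -- A component without a neighbour of some `x` in `X` would be degenerated, against
    -- well-separability. The two components for `split` are those in which `P` and `P′` live.
    sep⇒tight : ∀ {P P′ X} → P ∈ 𝒫 → P′ ∈ 𝒫 → Sep P P′ X → Tight k X
    sep⇒tight {P} {P′} {X} P∈𝒫 P′∈𝒫 s@(sepBy S order e@(S⊆X , X⊆S) dist) = record
      { resp  = X-resp
      ; size  = X-size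
      ; full  = full′
      ; split = let v , live = lives P∈𝒫 X-resp X-size ; v′ , live′ = lives P′∈𝒫 X-resp X-size
                in v , v′ , ∉separator live , ∉separator live′ , sep⇒apart s live live′
      }
      where
      X-resp : X Respects _≈_
      X-resp = sep-resp s
      X-size : HasSize vertices X k
      X-size = CV.hasSize-≐ e order
      full′ : ∀ {v x} → v ∉ X → x ∈ X → ∃[ u ] Conn X v u × u ~ x
      full′ {v} {x} v∉X x∈X = decidable-stable em λ none →
        wellSeparable k≡κ {S} ((k , ≤-refl , order) , P , P′ , P∈𝒫 , P′∈𝒫 , dist) (Conn (sep S) v)
          (v , (λ v∈S → v∉X (S⊆X v∈S)) , id , id)
          ( (λ {y} (y∉C , u , vu , u~y) → decidable-stable em λ y∉S →
              y∉C (vu ◅◅ inj₂ (u~y , conn-outside (separator-resp S) (λ v∈S → v∉X (S⊆X v∈S)) vu , y∉S) ◅ ε))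
          , λ S⊆N → let u , vu , u~x = proj₂ (S⊆N (X⊆S x∈X)) in none (u , conn-antitone X⊆S vu , u~x) )

    -- Corners and uncrossing

    module _ {X Y : Pred V ℓ} (tX : Tight k X) (tY : Tight k Y) where

      -- For the components `C` of `v` and `D` of `w`, the first side is (X ∪ C) ∩ (Y ∪ D), and its
      -- strict part is C ∩ D. A profile pointing into C ∩ D thus contains the reverse.
      corner : ∀ {v w} → v ∉ X → w ∉ Y → Separation G
      corner v∉X w∉Y = away (resp tX) v∉X ⁻ ⊓ away (resp tY) w∉Y ⁻

      corner⊆ : ∀ {v w} (v∉X : v ∉ X) (w∉Y : w ∉ Y) → sep (corner v∉X w∉Y) ⊆ X ∪ Y
      corner⊆ v∉X w∉Y ((inj₁ x∈X , _) , _)              = inj₁ x∈X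
      corner⊆ v∉X w∉Y ((inj₂ _ , inj₁ x∈Y) , _)         = inj₂ x∈Y
      corner⊆ v∉X w∉Y ((inj₂ vx , inj₂ _) , inj₁ ¬vx)   = contradiction vx ¬vx
      corner⊆ v∉X w∉Y ((inj₂ _ , inj₂ wx) , inj₂ ¬wx)   = contradiction wx ¬wx

      -- A vertex that is in `X` or the component of `v`, and also in `X` or a different component,
      -- is in `X`; the same holds for `Y`.
      corners-meet : ∀ {v v′ w w′} (v∉X : v ∉ X) (w∉Y : w ∉ Y) (v′∉X : v′ ∉ X) (w′∉Y : w′ ∉ Y) →
        ¬ Conn X v v′ → ¬ Conn Y w w′ → sep (corner v∉X w∉Y) ∩ sep (corner v′∉X w′∉Y) ⊆ X ∩ Y
      corners-meet _ _ _ _ ¬vv′ ¬ww′ (((x∈ , x∈′) , _) , ((x∈″ , x∈‴) , _)) =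
        both ¬vv′ x∈ x∈″ , both ¬ww′ x∈′ x∈‴
        where
        both : ∀ {Z u u′ x} → ¬ Conn Z u u′ → x ∈ Z ⊎ Conn Z u x → x ∈ Z ⊎ Conn Z u′ x → x ∈ Z
        both ¬uu′ (inj₁ x∈Z) _          = x∈Z
        both ¬uu′ (inj₂ _) (inj₁ x∈Z)   = x∈Z
        both ¬uu′ (inj₂ ux) (inj₂ u′x)  = contradiction (ux ◅◅ conn-sym u′x) ¬uu′

      -- `P` contains `S` and `T`, so (P2) keeps the corner out of `P`. `P′` contains the reverse of
      -- one of them, which lies above the corner, so (P1) keeps the reverse of the corner out of
      -- `P′`. One of the two separators telling the profiles apart is enough.
      corner-distinguishes : ∀ {P P′ v v′ w w′} → P ∈ 𝒫 → P′ ∈ 𝒫 →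
        (pv : Lives P X v) (pw : Lives P Y w) → Lives P′ X v′ → Lives P′ Y w′ →
        ¬ Conn X v v′ ⊎ ¬ Conn Y w w′ → let C = corner (∉separator pv) (∉separator pw) in
        OrderBelow (suc k) C → C ⁻ ∈ᵖ P × C ∈ᵖ P′
      corner-distinguishes {P} {P′} P∈𝒫 P′∈𝒫 pv pw pv′ pw′ ap small@(m , m< , size) = in-P , in-P′ ap
        where
        S = away (resp tX) (∉separator pv)
        T = away (resp tY) (∉separator pw)
        C = corner (∉separator pv) (∉separator pw)
        in-P : C ⁻ ∈ᵖ P
        in-P with Order.total P∈𝒫 C small
        ... | inj₁ C∈P  = contradiction C∈P (P2 P {S} {T} (away∈ P∈𝒫 tX pv) (away∈ P∈𝒫 tY pw))
        ... | inj₂ C⁻∈P = C⁻∈P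
        in-P′ : ¬ Conn X _ _ ⊎ ¬ Conn Y _ _ → C ∈ᵖ P′
        in-P′ ap with Order.total P′∈𝒫 C small
        ... | inj₁ C∈P′ = C∈P′
        in-P′ (inj₁ ¬vv′) | inj₂ C⁻∈P′ = contradiction C⁻∈P′
          (P1 P′ {S ⁻} {C} (proj₁ , inj₁) (proj₂ (distinguish P∈𝒫 P′∈𝒫 tX pv pv′ ¬vv′)))
        in-P′ (inj₂ ¬ww′) | inj₂ C⁻∈P′ = contradiction C⁻∈P′
          (P1 P′ {T ⁻} {C} (proj₂ , inj₂) (proj₂ (distinguish P∈𝒫 P′∈𝒫 tY pw pw′ ¬ww′)))

      corner-nested : ∀ {v w Z} (v∉X : v ∉ X) (w∉Y : w ∉ Y) →
        (∀ {z} → Conn X v z → z ∉ Z) → Nested (sep (corner v∉X w∉Y)) Z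
      corner-nested v∉X w∉Y avoid =
        attached-together {U = sep (corner v∉X w∉Y)} {sep (corner v∉X w∉Y)} tX v∉X avoid
          (λ ((z∈ , _) , _) → z∈) (λ ((z∈ , _) , _) → z∈)

      corner-nested′ : ∀ {v w Z} (v∉X : v ∉ X) (w∉Y : w ∉ Y) →
        (∀ {z} → Conn Y w z → z ∉ Z) → Nested (sep (corner v∉X w∉Y)) Z
      corner-nested′ v∉X w∉Y avoid =
        attached-together {U = sep (corner v∉X w∉Y)} {sep (corner v∉X w∉Y)} tY w∉Y avoid
          (λ ((_ , z∈) , _) → z∈) (λ ((_ , z∈) , _) → z∈)

      -- Since ∣κ₁∣ + ∣κ₂∣ ≤ 2k, both corners have order exactly k, the least order distinguishing two profiles.
      corner-sizes : ∀ {P P′ v v′ w w′} → P ∈ 𝒫 → P′ ∈ 𝒫 →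
        (pv : Lives P X v) (pw : Lives P Y w) (pv′ : Lives P′ X v′) (pw′ : Lives P′ Y w′) →
        ¬ Conn X v v′ → ¬ Conn Y w w′ →
        HasOrder (corner (∉separator pv) (∉separator pw)) k × HasOrder (corner (∉separator pv′) (∉separator pw′)) k
      corner-sizes {P} {P′} P∈𝒫 P′∈𝒫 pv pw pv′ pw′ ¬vv′ ¬ww′
        with i , j , i+j≤ , at , at′ ← CV.submodular (resp tX)
               (separator-resp (corner (∉separator pv) (∉separator pw)))
               (separator-resp (corner (∉separator pv′) (∉separator pw′)))
               (corner⊆ (∉separator pv) (∉separator pw)) (corner⊆ (∉separator pv′) (∉separator pw′))
               (corners-meet (∉separator pv) (∉separator pw) (∉separator pv′) (∉separator pw′) ¬vv′ ¬ww′)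
               (CV.hasSize⇒atMost (size tX)) (CV.hasSize⇒atMost (size tY))
        with m , m≤i , order ← CV.atMost⇒hasSize at | m′ , m′≤j , order′ ← CV.atMost⇒hasSize at′
        = exact (≤-trans (+-mono-≤ m≤i m′≤j) i+j≤) order order′
        where
        C = corner (∉separator pv) (∉separator pw)
        C′ = corner (∉separator pv′) (∉separator pw′)
        least : ∀ {m} → HasOrder C m → k ≤ m
        least {m} order = decidable-stable em λ k≰m → k≰m (minimal {C} (P′ , P , P′∈𝒫 , P∈𝒫 ,
          inj₁ (swap (corner-distinguishes P∈𝒫 P′∈𝒫 pv pw pv′ pw′ (inj₁ ¬vv′)
            (m , m≤n⇒m≤1+n (≰⇒> k≰m) , order)))) order)
        least′ : ∀ {m} → HasOrder C′ m → k ≤ m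
        least′ {m} order = decidable-stable em λ k≰m → k≰m (minimal {C′} (P , P′ , P∈𝒫 , P′∈𝒫 ,
          inj₁ (swap (corner-distinguishes P′∈𝒫 P∈𝒫 pv′ pw′ pv pw (inj₁ (¬vv′ ∘ conn-sym))
            (m , m≤n⇒m≤1+n (≰⇒> k≰m) , order)))) order)
        exact : ∀ {m m′} → m + m′ ≤ k + k → HasOrder C m → HasOrder C′ m′ → HasOrder C k × HasOrder C′ k
        exact m+m′≤ order order′ =
          subst (HasOrder C) (≤-antisym (+-cancelʳ-≤ k _ k (≤-trans (+-monoʳ-≤ _ (least′ order′)) m+m′≤))
            (least order)) order ,
          subst (HasOrder C′) (≤-antisym (+-cancelˡ-≤ k _ k (≤-trans (+-monoˡ-≤ _ (least order)) m+m′≤))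
            (least′ order′)) order′

    -- The separators `κ` and `κ′` of two opposite corners, with total crossing number below `n`.
    -- They are compared with an arbitrary third profile `Q`, because they must compete with `X` and
    -- `Y` for the pairs that those were chosen for.
    record Uncrossed (P P′ : Profile G) (X Y : Pred V ℓ) (v w v′ w′ : V) (n : ℕ) : Set (lsuc ℓ) where
      field
        {κ κ′}    : Pred V ℓ
        {i j}     : ℕ
        i+j<n     : i + j < n
        crossing  : CS.AtMost i (Crossing κ)
        crossing′ : CS.AtMost j (Crossing κ′)
        sepFrom   : ∀ {Q x y} → Q ∈ 𝒫 → Lives Q X x → Lives Q Y y → ¬ Conn X v x ⊎ ¬ Conn Y w y → Sep P Q κ
        sepFrom′  : ∀ {Q x y} → Q ∈ 𝒫 → Lives Q X x → Lives Q Y y → ¬ Conn X v′ x ⊎ ¬ Conn Y w′ y → Sep P′ Q κ′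

    𝒳-tight : ∀ {Z} → Z ∈ 𝒳 → Tight k Z
    𝒳-tight (_ , _ , P∈ , P′∈ , s) = sep⇒tight P∈ P′∈ s

    uncross : ∀ {P P′ X Y v v′ w w′ m n} → P ∈ 𝒫 → P′ ∈ 𝒫 → X ∈ 𝒳 → Y ∈ 𝒳 → ¬ Nested X Y →
      Lives P X v → Lives P Y w → Lives P′ X v′ → Lives P′ Y w′ → ¬ Conn X v v′ → ¬ Conn Y w w′ →
      CS.AtMost m (Crossing X) → CS.AtMost n (Crossing Y) → Uncrossed P P′ X Y v w v′ w′ (m + n)
    uncross {P} {P′} {X} {Y} {v} {v′} {w} {w′} P∈𝒫 P′∈𝒫 X∈𝒳 Y∈𝒳 cross pv pw pv′ pw′ ¬vv′ ¬ww′ atX atY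
      = record
        { i+j<n = proj₁ counts ; crossing = proj₁ (proj₂ counts) ; crossing′ = proj₂ (proj₂ counts)
        ; sepFrom = λ Q∈𝒫 qx qy ap →
            let C⁻∈P , C∈Q = corner-distinguishes tX tY P∈𝒫 Q∈𝒫 pv pw qx qy ap (k , ≤-refl , order) in
            sepBy C order (id , id) (inj₂ (C⁻∈P , C∈Q))
        ; sepFrom′ = λ Q∈𝒫 qx qy ap →
            let C⁻∈P , C∈Q = corner-distinguishes tX tY P′∈𝒫 Q∈𝒫 pv′ pw′ qx qy ap (k , ≤-refl , order′) in
            sepBy C′ order′ (id , id) (inj₂ (C⁻∈P , C∈Q))
        }
      where
      tX = 𝒳-tight X∈𝒳
      tY = 𝒳-tight Y∈𝒳
      v∉X = ∉separator pv
      w∉Y = ∉separator pw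
      v′∉X = ∉separator pv′
      w′∉Y = ∉separator pw′
      C = corner tX tY v∉X w∉Y
      C′ = corner tX tY v′∉X w′∉Y
      κ = sep C
      κ′ = sep C′
      orders : HasOrder C k × HasOrder C′ k
      orders = corner-sizes tX tY P∈𝒫 P′∈𝒫 pv pw pv′ pw′ ¬vv′ ¬ww′
      order = proj₁ orders
      order′ = proj₂ orders
      crosses-one : ∀ {κ : Pred V ℓ} → κ ⊆ X ∪ Y → Crossing κ ⊆ Crossing X ∪ Crossing Y
      crosses-one κ⊆ {Z} (Z∈𝒳 , crossκ) with em {P = Nested X Z}
      ... | no crossX = inj₁ (Z∈𝒳 , crossX)
      -- A `Z` nested with both `X` and `Y` is nested with any subset of their union.
      ... | yes XZ = inj₂ (Z∈𝒳 , λ YZ → crossκ (nested-∪ (𝒳-tight Z∈𝒳) cross XZ YZ κ⊆))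
      crosses-both : Crossing κ ∩ Crossing κ′ ⊆ Crossing X ∩ Crossing Y
      crosses-both {Z} ((Z∈𝒳 , crossκ) , (_ , crossκ′)) = (Z∈𝒳 , crossX) , (Z∈𝒳 , crossY)
        where
        crossX : ¬ Nested X Z
        -- If `Z` does not cross `X`, it misses the component of `v` or that of `v′`. The corner
        -- there has its separator in `X` and this component, so `Z` cannot separate it.
        crossX XZ with component-avoids tX (nested-sym (𝒳-tight Z∈𝒳) XZ) v∉X v′∉X ¬vv′
        ... | inj₁ avoid = crossκ (corner-nested tX tY v∉X w∉Y avoid)
        ... | inj₂ avoid = crossκ′ (corner-nested tX tY v′∉X w′∉Y avoid)
        crossY : ¬ Nested Y Z
        crossY YZ with component-avoids tY (nested-sym (𝒳-tight Z∈𝒳) YZ) w∉Y w′∉Y ¬ww′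
        ... | inj₁ avoid = crossκ (corner-nested′ tX tY v∉X w∉Y avoid)
        ... | inj₂ avoid = crossκ′ (corner-nested′ tX tY v′∉X w′∉Y avoid)
      counts = proj₂ (proj₂ (CS.submodular-strict {K = Crossing κ} {L = Crossing κ′}
             (crossing-resp X) (crossing-resp κ) (crossing-resp κ′)
             (crosses-one (corner⊆ tX tY v∉X w∉Y)) (crosses-one (corner⊆ tX tY v′∉X w′∉Y)) crosses-both
             -- The strict gain comes from `X` itself: it crosses `Y` but neither corner, since each
             -- corner separator lies in `X` and a single component of `G - X`.
             atX atY (X∈𝒳 , λ nested → cross (nested-sym tX nested))
             (λ (_ , crossX) → crossX (corner-nested tX tY v∉X w∉Y (outside tX v∉X)))
             (λ (_ , crossX) → crossX (corner-nested tX tY v′∉X w′∉Y (outside tX v′∉X)))))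

    -- Members of `𝒳` are tight, so crossing numbers are finite and a descent on their bounds ends.
    optimal-exists : ∀ {P P′ X} → P ∈ 𝒫 → P′ ∈ 𝒫 → Sep P P′ X → ∃₂ λ Y n → Optimal P P′ Y n
    optimal-exists {P} {P′} P∈𝒫 P′∈𝒫 s = let n , at = finite s in search (<-wellFounded n) s at
      where
      finite : ∀ {X} → Sep P P′ X → CS.Finite (Crossing X)
      finite s = let at = _ , CV.hasSize⇒atMost (size (sep⇒tight P∈𝒫 P′∈𝒫 s)) in
        CS.finite-⊆ (λ (Z∈𝒳 , cross) → 𝒳-tight Z∈𝒳 , cross) (apart-finite at at)
      search : ∀ {X n} → Acc _<_ n → Sep P P′ X → CS.AtMost n (Crossing X) → ∃₂ λ Y m → Optimal P P′ Y m
      search {X} {n} (acc rs) s at with em {P = ∃₂ λ Y m → Sep P P′ Y × CS.AtMost m (Crossing Y) × m < n}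
      ... | yes (Y , m , s′ , at′ , m<n) = search (rs m<n) s′ at′
      ... | no none = X , n , s , at , λ s′ at′ → decidable-stable em λ n≰m → none (_ , _ , s′ , at′ , ≰⇒> n≰m)

    -- If `X` and `Y` crossed, `clash` would force each of them to separate both pairs. Then
    -- uncrossing along the pair of `X` gives `m < n`, and along the pair of `Y` it gives `n < m`.
    optimal-nested : ∀ {X Y} → X ∈ 𝒩 → Y ∈ 𝒩 → Nested X Y
    optimal-nested {X} {Y} (P , P′ , P∈ , P′∈ , m , optX@(sepX , atX , _))
                   (Q , Q′ , Q∈ , Q′∈ , n , optY@(sepY , atY , _)) =
      decidable-stable em crossing-impossible
      where
      X∈𝒳 : X ∈ 𝒳
      X∈𝒳 = P , P′ , P∈ , P′∈ , sepX
      Y∈𝒳 : Y ∈ 𝒳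
      Y∈𝒳 = Q , Q′ , Q∈ , Q′∈ , sepY
      tX = 𝒳-tight X∈𝒳
      tY = 𝒳-tight Y∈𝒳

      record Located (R : Profile G) : Set (lsuc ℓ) where
        field
          {v w} : V
          R∈𝒫   : R ∈ 𝒫
          inX   : Lives R X v
          inY   : Lives R Y w
      open Located

      locate : ∀ {R} → R ∈ 𝒫 → Located R
      locate R∈ = record
        { R∈𝒫 = R∈ ; inX = proj₂ (lives R∈ (resp tX) (size tX)) ; inY = proj₂ (lives R∈ (resp tY) (size tY)) }

      ApartX ApartY : ∀ {R S} → Located R → Located S → Set ℓ
      ApartX r s = ¬ Conn X (v r) (v s)
      ApartY r s = ¬ Conn Y (w r) (w s)

      p = locate P∈
      p′ = locate P′∈
      q = locate Q∈
      q′ = locate Q′∈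

      uncrossed : ¬ Nested X Y → ∀ {R S} (r : Located R) (s : Located S) → ApartX r s → ApartY r s →
        Uncrossed R S X Y (v r) (w r) (v s) (w s) (m + n)
      uncrossed cross r s apX apY =
        uncross (R∈𝒫 r) (R∈𝒫 s) X∈𝒳 Y∈𝒳 cross (inX r) (inY r) (inX s) (inY s) apX apY atX atY

      -- The corner of `R` still separates `R` from its partner, as `X` does, and the corner of `S`
      -- separates `S` from its partner, as `Y` does. By optimality their crossing numbers add up to
      -- at least `m + n`, which uncrossing forbids.
      clash : ¬ Nested X Y → ∀ {R R′ S S′} (r : Located R) (r′ : Located R′) (s : Located S) (s′ : Located S′) →
        Optimal R R′ X m → Optimal S S′ Y n → ApartX r s → ¬ ApartY r s
      clash cross r r′ s s′ (sX , _ , leastX) (sY , _ , leastY) apX apY =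
        <⇒≱ i+j<n (+-mono-≤
          (leastX (sepFrom (R∈𝒫 r′) (inX r′) (inY r′)
             (inj₁ (sep⇒apart sX (inX r) (inX r′)))) crossing)
          (leastY (sepFrom′ (R∈𝒫 s′) (inX s′) (inY s′)
             (inj₂ (sep⇒apart sY (inY s) (inY s′)))) crossing′))
        where open Uncrossed (uncrossed cross r s apX apY)

      -- Here `R` and `S` form one pair, and both opposite corners separate it, so each has crossing
      -- number at least `l`.
      both-corners : ¬ Nested X Y → ∀ {R S Z l} (r : Located R) (s : Located S) → ApartX r s → ApartY r s →
        Optimal R S Z l → l + l < m + n
      both-corners cross r s apX apY (_ , _ , least) =
        ≤-<-trans (+-mono-≤
          (least (sepFrom (R∈𝒫 s) (inX s) (inY s) (inj₁ apX)) crossing)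
          (least (sep-sym (sepFrom′ (R∈𝒫 r) (inX r) (inY r) (inj₁ (apX ∘ conn-sym)))) crossing′)) i+j<n
        where open Uncrossed (uncrossed cross r s apX apY)

      module _ (cross : ¬ Nested X Y) where
        pp′X : ApartX p p′
        pp′X = sep⇒apart sepX (inX p) (inX p′)
        qq′Y : ApartY q q′
        qq′Y = sep⇒apart sepY (inY q) (inY q′)

        optX′ = optimal-sym optX
        optY′ = optimal-sym optY

        joinedX : ∀ {R R′ S S′} (r : Located R) (r′ : Located R′) (s : Located S) (s′ : Located S′) →
          Optimal R R′ X m → Optimal S S′ Y n → ApartY r s → Conn X (v r) (v s)
        joinedX r r′ s s′ oX oY apY = decidable-stable em λ apX → clash cross r r′ s s′ oX oY apX apY

        joinedY : ∀ {R R′ S S′} (r : Located R) (r′ : Located R′) (s : Located S) (s′ : Located S′) →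
          Optimal R R′ X m → Optimal S S′ Y n → ApartX r s → Conn Y (w r) (w s)
        joinedY r r′ s s′ oX oY apX = decidable-stable em λ apY → clash cross r r′ s s′ oX oY apX apY

        -- If `P` and `P′` shared a component of `G - Y`, then one of `Q` and `Q′` would live
        -- outside it, and by `joinedX` it would share a component of `G - X` with both.
        pp′Y : ApartY p p′
        pp′Y pp′ with em {P = Conn Y (w p) (w q)}
        ... | no pq = pp′X (joinedX p p′ q q′ optX optY pq ◅◅
                conn-sym (joinedX p′ p q q′ optX′ optY λ p′q → pq (pp′ ◅◅ p′q)))
        ... | yes pq = pp′X (joinedX p p′ q′ q optX optY′ pq′ ◅◅
                conn-sym (joinedX p′ p q′ q optX′ optY′ λ p′q′ → pq′ (pp′ ◅◅ p′q′)))
          where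
          pq′ : ApartY p q′
          pq′ pq′ = qq′Y (conn-sym pq ◅◅ pq′)

        qq′X : ApartX q q′
        qq′X qq′ with em {P = Conn X (v p) (v q)}
        ... | no pq = qq′Y (conn-sym (joinedY p p′ q q′ optX optY pq) ◅◅
                joinedY p p′ q′ q optX optY′ λ pq′ → pq (pq′ ◅◅ conn-sym qq′))
        ... | yes pq = qq′Y (conn-sym (joinedY p′ p q q′ optX′ optY p′q) ◅◅
                joinedY p′ p q′ q optX′ optY′ λ p′q′ → p′q (p′q′ ◅◅ conn-sym qq′))
          where
          p′q : ApartX p′ q
          p′q p′q = pp′X (pq ◅◅ conn-sym p′q)

        crossing-impossible : ⊥
        crossing-impossible = <-asym
          (+-cancelˡ-< m m n (both-corners cross p p′ pp′X pp′Y optX))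
          (+-cancelʳ-< n n m (both-corners cross q q′ qq′X qq′Y optY))

    𝒩-tight : ∀ {X} → X ∈ 𝒩 → Tight k X
    𝒩-tight (_ , _ , P∈ , P′∈ , _ , s , _) = sep⇒tight P∈ P′∈ s

    𝒩-distinguishes : ∀ {P P′} → P ∈ 𝒫 → P′ ∈ 𝒫 → Distinguishable k P P′ → ∃[ X ] X ∈ 𝒩 × Sep P P′ X
    𝒩-distinguishes {P} {P′} P∈ P′∈ (S , (m , m≤k , order) , dist)
      -- A separation of order at most `k` that distinguishes members of `𝒫` has order exactly `k`.
      with refl ← ≤-antisym m≤k (minimal {S} (P , P′ , P∈ , P′∈ , dist) order)
      with X , n , opt@(s , _) ← optimal-exists P∈ P′∈ (sepBy S order (id , id) dist) =
      X , (P , P′ , P∈ , P′∈ , n , opt) , s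

    𝒩-inhabited : ∃[ X ] X ∈ 𝒩
    𝒩-inhabited = let S , order , P , P′ , P∈ , P′∈ , dist = attained
                      X , X∈𝒩 , _ = 𝒩-distinguishes P∈ P′∈ (S , (k , ≤-refl , order) , dist)
                  in X , X∈𝒩

-- Nodes, directions and parts

module Nodes (em : ∀ {a} → ExcludedMiddle a) {ℓ} (G : Graph ℓ) (𝒩 : Pred (Pred (Graph.V G) ℓ) (lsuc ℓ)) where
  open Graph G
  open Separators em G

  -- block X v is the part of the tree-decomposition next to X in the component of G - X containing v.
  data Node : Set (lsuc ℓ) where
    hub   : ∀ X → X ∈ 𝒩 → Node
    block : ∀ X → X ∈ 𝒩 → ∀ v → v ∉ X → Node

  isHub : Node → Bool
  isHub (hub _ _)       = true
  isHub (block _ _ _ _) = false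

  Toward : (Y X : Pred V ℓ) → Pred V ℓ
  Toward Y X w = ∃[ x ] x ∈ X × x ∉ Y × Conn Y x w

  -- The component of G - Y containing the rest of the node s; empty if s is the hub Y.
  dir : Pred V ℓ → Node → Pred V ℓ
  dir Y (hub X _)       = Toward Y X
  dir Y (block X _ v _) = Toward Y X ∪ λ w → X ⊆ Y × Conn Y v w

  infix 4 _≈ᵀ_ _~ᵀ_

  -- The same block can arise from several choices of `X` and `v`, so nodes are compared by how `𝒩`
  -- sees them and not by their data.
  record _≈ᵀ_ (s t : Node) : Set (lsuc ℓ) where
    field
      kind : isHub s ≡ isHub t
      dirs : ∀ {Y} → Y ∈ 𝒩 → dir Y s ≐ dir Y t

  -- Only the hub X is empty in direction X, so a hub X is adjacent to the blocks which every Y ≠ X in 𝒩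
  -- sees in the same component as X.
  record _~ᵀ_ (s t : Node) : Set (lsuc ℓ) where
    field
      kinds : isHub s ≢ isHub t
      agree : ∀ {Y u w} → Y ∈ 𝒩 → u ∈ dir Y s → w ∈ dir Y t → Conn Y u w

  open _≈ᵀ_ public
  open _~ᵀ_ public

  ≈ᵀ-refl : ∀ {s} → s ≈ᵀ s
  ≈ᵀ-refl = record { kind = refl ; dirs = λ _ → id , id }

  ≈ᵀ-sym : ∀ {s t} → s ≈ᵀ t → t ≈ᵀ s
  ≈ᵀ-sym e = record { kind = sym (kind e) ; dirs = λ Y∈ → swap (dirs e Y∈) }

  ≈ᵀ-trans : ∀ {s t u} → s ≈ᵀ t → t ≈ᵀ u → s ≈ᵀ u
  ≈ᵀ-trans e f = record
    { kind = trans (kind e) (kind f)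
    ; dirs = λ Y∈ → (λ x → proj₁ (dirs f Y∈) (proj₁ (dirs e Y∈) x)) , λ x → proj₂ (dirs e Y∈) (proj₂ (dirs f Y∈) x)
    }

  ~ᵀ-sym : ∀ {s t} → s ~ᵀ t → t ~ᵀ s
  ~ᵀ-sym e = record { kinds = λ eq → kinds e (sym eq) ; agree = λ Y∈ u∈ w∈ → conn-sym (agree e Y∈ w∈ u∈) }

  ~ᵀ-respʳ : ∀ {s t u} → t ≈ᵀ u → s ~ᵀ t → s ~ᵀ u
  ~ᵀ-respʳ e a = record
    { kinds = λ eq → kinds a (trans eq (sym (kind e)))
    ; agree = λ Y∈ u∈ w∈ → agree a Y∈ u∈ (proj₂ (dirs e Y∈) w∈)
    }

  tree : Graph (lsuc ℓ)
  tree = record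
    { vertices = record
      { Carrier = Node ; _≈_ = _≈ᵀ_
      ; isEquivalence = record { refl = ≈ᵀ-refl ; sym = ≈ᵀ-sym ; trans = ≈ᵀ-trans } }
    ; _~_      = _~ᵀ_
    ; ~-resp-≈ = ~ᵀ-respʳ , λ e a → ~ᵀ-sym (~ᵀ-respʳ e (~ᵀ-sym a))
    ; ~-sym    = ~ᵀ-sym
    ; ~-irrefl = λ e a → kinds a (kind e)
    }

  -- Each `Y` cuts the part down to itself and its direction toward the node. At the hub `X` the
  -- direction `X` is empty, which leaves only `X`.
  part : Node → Pred V (lsuc ℓ)
  part s v = ∀ {Y} → Y ∈ 𝒩 → v ∈ Y ⊎ v ∈ dir Y s

  dir-closed : ∀ {Y s u w} → u ∈ dir Y s → Conn Y u w → w ∈ dir Y s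
  dir-closed {s = hub _ _} (x , x∈ , x∉ , xu) uw = x , x∈ , x∉ , xu ◅◅ uw
  dir-closed {s = block _ _ _ _} (inj₁ (x , x∈ , x∉ , xu)) uw = inj₁ (x , x∈ , x∉ , xu ◅◅ uw)
  dir-closed {s = block _ _ _ _} (inj₂ (X⊆Y , vu)) uw = inj₂ (X⊆Y , vu ◅◅ uw)

  dir-≐ : ∀ {Y Z s} → Y ≐ Z → dir Y s ⊆ dir Z s
  dir-≐ {Y} {Z} {s} (Y⊆Z , Z⊆Y) = go s
    where
    toward : ∀ {X} → Toward Y X ⊆ Toward Z X
    toward (x , x∈ , x∉Y , xw) = x , x∈ , (λ x∈Z → x∉Y (Z⊆Y x∈Z)) , conn-antitone Z⊆Y xw
    go : ∀ s → dir Y s ⊆ dir Z s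
    go (hub _ _) t = toward t
    go (block _ _ _ _) (inj₁ t) = inj₁ (toward t)
    go (block _ _ _ _) (inj₂ (X⊆Y , vw)) = inj₂ ((λ x∈ → Y⊆Z (X⊆Y x∈)) , conn-antitone Z⊆Y vw)

-- The tree-decomposition given by a nested set of tight sets

module Trees (em : ∀ {a} → ExcludedMiddle a) {ℓ} (G : Graph ℓ) (𝒩 : Pred (Pred (Graph.V G) ℓ) (lsuc ℓ))
  (k : ℕ) (tight : ∀ {X} → X ∈ 𝒩 → Separators.Tight em G k X)
  (nested : ∀ {X Y} → X ∈ 𝒩 → Y ∈ 𝒩 → Separators.Nested em G X Y)
  (inhabited : ∃[ X ] X ∈ 𝒩) where
  open Graph G
  open Separators em G
  open Nodes em G 𝒩
  open Tight
  private module V = Setoid vertices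
  private module CV = Counting em vertices
  private module CS = Counting em (≐-setoid V ℓ)

  equal : ∀ {X Y} → X ∈ 𝒩 → Y ∈ 𝒩 → X ⊆ Y → Y ⊆ X
  equal X∈ Y∈ = CV.equal-size (resp (tight X∈)) (size (tight X∈)) (size (tight Y∈))

  -- Within `Toward` this is nestedness. The two clauses for a block exclude each other: one needs a
  -- vertex of `X` outside `Y`, the other needs `X ⊆ Y`.
  dir-conn : ∀ {Y s u w} → Y ∈ 𝒩 → u ∈ dir Y s → w ∈ dir Y s → Conn Y u w
  dir-conn {Y} {s} Y∈ = go s
    where
    toward : ∀ {X u w} → X ∈ 𝒩 → u ∈ Toward Y X → w ∈ Toward Y X → Conn Y u w
    toward X∈ (x , x∈ , x∉ , xu) (y , y∈ , y∉ , yw) = conn-sym xu ◅◅ nested X∈ Y∈ x∈ x∉ y∈ y∉ ◅◅ yw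
    go : ∀ s {u w} → u ∈ dir Y s → w ∈ dir Y s → Conn Y u w
    go (hub _ X∈) t t′ = toward X∈ t t′
    go (block _ X∈ _ _) (inj₁ t) (inj₁ t′) = toward X∈ t t′
    go (block _ _ _ _) (inj₁ (_ , x∈ , x∉ , _)) (inj₂ (X⊆Y , _)) = contradiction (X⊆Y x∈) x∉
    go (block _ _ _ _) (inj₂ (X⊆Y , _)) (inj₁ (_ , x∈ , x∉ , _)) = contradiction (X⊆Y x∈) x∉
    go (block _ _ _ _) (inj₂ (_ , vu)) (inj₂ (_ , vw)) = conn-sym vu ◅◅ vw

  dir-outside : ∀ {Y s w} → Y ∈ 𝒩 → w ∈ dir Y s → w ∉ Y
  dir-outside {s = hub _ _} Y∈ (_ , _ , x∉ , xw) = outside (tight Y∈) x∉ xw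
  dir-outside {s = block _ _ _ _} Y∈ (inj₁ (_ , _ , x∉ , xw)) = outside (tight Y∈) x∉ xw
  dir-outside {s = block _ X∈ _ v∉X} Y∈ (inj₂ (X⊆Y , vw)) =
    outside (tight Y∈) (λ v∈Y → v∉X (equal X∈ Y∈ X⊆Y v∈Y)) vw

  dir-meet : ∀ {Y s t w} → Y ∈ 𝒩 → w ∈ dir Y s → w ∈ dir Y t → dir Y s ≐ dir Y t
  dir-meet {s = s} {t} Y∈ w∈s w∈t =
    (λ u∈s → dir-closed {s = t} w∈t (dir-conn {s = s} Y∈ w∈s u∈s)) ,
    (λ u∈t → dir-closed {s = s} w∈s (dir-conn {s = t} Y∈ w∈t u∈t))

  ⊈⇒∃ : ∀ {X Y : Pred V ℓ} → ¬ X ⊆ Y → ∃[ x ] x ∈ X × x ∉ Y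
  ⊈⇒∃ X⊈Y = decidable-stable em λ none → X⊈Y λ x∈X → decidable-stable em λ x∉Y → none (_ , x∈X , x∉Y)

  block-inhabited : ∀ {Y s} → isHub s ≡ false → ∃[ w ] w ∈ dir Y s
  block-inhabited {Y} {block X _ v _} refl with em {P = X ⊆ Y}
  ... | yes X⊆Y = v , inj₂ (X⊆Y , ε)
  ... | no X⊈Y with x , x∈ , x∉ ← ⊈⇒∃ X⊈Y = x , inj₁ (x , x∈ , x∉ , ε)

  hub-empty : ∀ {X X∈ s w} → s ≈ᵀ hub X X∈ → w ∉ dir X s
  hub-empty {X∈ = X∈} e w∈ with _ , x∈ , x∉ , _ ← proj₁ (dirs e X∈) w∈ = x∉ x∈

  hub-cong : ∀ {X Y X∈ Y∈} → X ≐ Y → hub X X∈ ≈ᵀ hub Y Y∈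
  hub-cong (X⊆Y , Y⊆X) = record { kind = refl ; dirs = λ _ →
    (λ (x , x∈ , rest) → x , X⊆Y x∈ , rest) , λ (x , x∈ , rest) → x , Y⊆X x∈ , rest }

  empty⇒hub : ∀ {Y s} (Y∈ : Y ∈ 𝒩) → (∀ {w} → w ∉ dir Y s) → s ≈ᵀ hub Y Y∈
  empty⇒hub {s = hub X X∈} Y∈ empty =
    let X⊆Y = λ {x} x∈X → decidable-stable em λ x∉Y → empty (x , x∈X , x∉Y , ε)
    in hub-cong (X⊆Y , equal X∈ Y∈ X⊆Y)
  empty⇒hub {Y} {s = block X X∈ v v∉X} Y∈ empty =
    contradiction (proj₂ (block-inhabited {Y} {block X X∈ v v∉X} refl)) empty

  hub-view : ∀ {s} → isHub s ≡ true → ∃₂ λ X X∈ → s ≈ᵀ hub X X∈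
  hub-view {hub X X∈} _ = X , X∈ , ≈ᵀ-refl

  -- An edge of the tree leaves a component of `G - Y` only by entering the hub `Y`, the one node
  -- without a direction at `Y`.
  cross-edge : ∀ {Y s t w} (Y∈ : Y ∈ 𝒩) → s ~ᵀ t → w ∈ dir Y s → w ∈ dir Y t ⊎ t ≈ᵀ hub Y Y∈
  cross-edge {Y} {s} {t} Y∈ s~t w∈ with em {P = ∃[ u ] u ∈ dir Y t}
  ... | yes (u , u∈) = inj₁ (dir-closed {s = t} u∈ (conn-sym (agree s~t Y∈ w∈ u∈)))
  ... | no none = inj₂ (empty⇒hub Y∈ λ w∈ → none (_ , w∈))

  block-next-to-hub : ∀ {X X∈ s} → s ~ᵀ hub X X∈ → isHub s ≡ false
  block-next-to-hub {s = hub _ _} s~ = contradiction refl (kinds s~)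
  block-next-to-hub {s = block _ _ _ _} _ = refl

  -- A `Y` that does not contain `X` sees both blocks where it sees the hub `X`. A `Y` that contains
  -- `X` equals it, and there the common vertex `w` decides.
  same-block : ∀ {X X∈ s t w} → s ~ᵀ hub X X∈ → t ~ᵀ hub X X∈ → w ∈ dir X s → w ∈ dir X t → s ≈ᵀ t
  same-block {X} {X∈} {s} {t} s~ t~ w∈s w∈t = record
    { kind = trans (block-next-to-hub s~) (sym (block-next-to-hub t~)) ; dirs = λ Y∈ → at Y∈ em }
    where
    at : ∀ {Y} → Y ∈ 𝒩 → Dec (∃[ u ] u ∈ Toward Y X) → dir Y s ≐ dir Y t
    at {Y} Y∈ (yes (u , u∈)) = dir-meet {s = s} {t} Y∈ (into s~) (into t~)
      where
      into : ∀ {s} → s ~ᵀ hub X X∈ → u ∈ dir Y s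
      into {s} s~ =
        let v , v∈ = block-inhabited {Y} (block-next-to-hub s~) in dir-closed {s = s} v∈ (agree s~ Y∈ v∈ u∈)
    at {Y} Y∈ (no none) = dir-meet {s = s} {t} Y∈ (dir-≐ {s = s} X≐Y w∈s) (dir-≐ {s = t} X≐Y w∈t)
      where
      X⊆Y : X ⊆ Y
      X⊆Y x∈X = decidable-stable em λ x∉Y → none (_ , _ , x∈X , x∉Y , ε)
      X≐Y : X ≐ Y
      X≐Y = X⊆Y , equal X∈ Y∈ X⊆Y

  block~hub : ∀ {X} (X∈ : X ∈ 𝒩) {v} (v∉X : v ∉ X) → block X X∈ v v∉X ~ᵀ hub X X∈
  block~hub X∈ v∉X = record
    { kinds = λ ()
    ; agree = λ { Y∈ (inj₁ u∈) w∈ → dir-conn {s = hub _ X∈} Y∈ u∈ w∈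
                ; Y∈ (inj₂ (X⊆Y , _)) (_ , x∈ , x∉ , _) → contradiction (X⊆Y x∈) x∉ } }

  -- Connectedness, and parts containing unseparated sets

  module _ {W : Pred V ℓ} (W-nested : ∀ {Y} → Y ∈ 𝒩 → Nested W Y) where

    -- A set separating `X` from `Y`, or `Y` from `W`, also separates `X` from `W`. It is not `Y`,
    -- because `Y` separates nothing from itself, so both counts drop.
    closer : ∀ {X Y n} → X ∈ 𝒩 → Y ∈ 𝒩 → ¬ Together Y X W → CS.AtMost n (λ Z → Z ∈ 𝒩 × ¬ Together Z X W) →
      ∃[ m ] n ≡ suc m × CS.AtMost m (λ Z → Z ∈ 𝒩 × ¬ Together Z X Y) × CS.AtMost m (λ Z → Z ∈ 𝒩 × ¬ Together Z Y W)
    closer {X} {Y} X∈ Y∈ ¬YXW at with m , eq , at′ ← CS.atMost-without at (Y∈ , ¬YXW) = m , eq ,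
      CS.atMost-⊆ (λ (Z∈ , ¬ZXY) →
        (Z∈ , apart-sym {_} {W} {X} (separated-between (tight Z∈) (nested Y∈ Z∈) (nested X∈ Z∈)
                (apart-sym {Y} {X} {W} ¬YXW) (apart-sym {_} {X} {Y} ¬ZXY))) ,
        λ Z≐Y → ¬ZXY λ _ _ y∈Y y∉Z → contradiction (proj₂ Z≐Y y∈Y) y∉Z) at′ ,
      CS.atMost-⊆ (λ (Z∈ , ¬ZYW) →
        (Z∈ , separated-between (tight Z∈) (nested Y∈ Z∈) (W-nested Z∈) ¬YXW ¬ZYW) ,
        λ Z≐Y → ¬ZYW λ y∈Y y∉Z → contradiction (proj₂ Z≐Y y∈Y) y∉Z) at′

    toward-W : ∀ {X v Y w} (X∈ : X ∈ 𝒩) (v∉X : v ∉ X) → v ∈ W → (∀ {Z} → Z ∈ 𝒩 → Together Z X W) →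
      Y ∈ 𝒩 → w ∈ W → w ∉ Y → w ∈ dir Y (block X X∈ v v∉X)
    toward-W {X} {v} {Y} X∈ v∉X v∈W together Y∈ w∈W w∉Y with em {P = X ⊆ Y}
    ... | yes X⊆Y = inj₂ (X⊆Y , W-nested Y∈ v∈W (λ v∈Y → v∉X (equal X∈ Y∈ X⊆Y v∈Y)) w∈W w∉Y)
    ... | no X⊈Y with x , x∈X , x∉Y ← ⊈⇒∃ X⊈Y = inj₁ (x , x∈X , x∉Y , together Y∈ x∈X x∉Y w∈W w∉Y)

  hub⊆part : ∀ {X X∈} → X ⊆ part (hub X X∈)
  hub⊆part {X} {X∈} x∈X {Y} Y∈ with em {P = _ ∈ Y}
  ... | yes x∈Y = inj₁ x∈Y
  ... | no x∉Y = inj₂ (_ , x∈X , x∉Y , ε)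

  part⊆hub : ∀ {X X∈} → part (hub X X∈) ⊆ X
  part⊆hub {X} {X∈} x∈ with x∈ X∈
  ... | inj₁ x∈X = x∈X
  ... | inj₂ x∈dir = contradiction x∈dir (hub-empty {X∈ = X∈} ≈ᵀ-refl)

  apart-all : ∀ {X W} → (∀ {Y} → Y ∈ 𝒩 → Together Y X W) ⊎ ∃[ Y ] Y ∈ 𝒩 × ¬ Together Y X W
  apart-all {X} {W} with em {P = ∃[ Y ] Y ∈ 𝒩 × ¬ Together Y X W}
  ... | yes some = inj₂ some
  ... | no none = inj₁ λ {Y} Y∈ → decidable-stable (em {P = Together Y X W}) λ ¬t → none (Y , Y∈ , ¬t)

  -- Starting from any hub, move to a member of `𝒩` separating it from `W` as long as there is one;
  -- `closer` makes this stop. Then `W` lies in the last hub or in a block next to it.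
  contained : ∀ {W} → (∀ {Y} → Y ∈ 𝒩 → Nested W Y) → CV.Finite W → ∃[ s ] W ⊆ part s
  contained {W} W-nested fin = let X₀ , X₀∈ = inhabited in
    search X₀∈ (proj₂ (CS.finite-⊆ (λ (Z∈ , ¬t) → tight Z∈ , ¬t)
      (apart-finite (_ , CV.hasSize⇒atMost (size (tight X₀∈))) fin)))
    where
    search : ∀ {n X} → X ∈ 𝒩 → CS.AtMost n (λ Z → Z ∈ 𝒩 × ¬ Together Z X W) → ∃[ s ] W ⊆ part s
    search {n} {X} X∈ at with apart-all {X} {W}
    search {n} {X} X∈ at | inj₂ (Y , Y∈ , ¬t) with closer W-nested X∈ Y∈ ¬t at
    ... | m , refl , _ , at′ = search Y∈ at′
    search {n} {X} X∈ at | inj₁ together with em {P = W ⊆ X}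
    ... | yes W⊆X = hub X X∈ , λ w∈W → hub⊆part {X∈ = X∈} (W⊆X w∈W)
    ... | no W⊈X with v , v∈W , v∉X ← ⊈⇒∃ W⊈X = block X X∈ v v∉X , λ {w} w∈W {Y} Y∈ → case w∈W Y∈ em
      where
      case : ∀ {w Y} → w ∈ W → Y ∈ 𝒩 → Dec (w ∈ Y) → w ∈ Y ⊎ w ∈ dir Y (block X X∈ v v∉X)
      case w∈W Y∈ (yes w∈Y) = inj₁ w∈Y
      case w∈W Y∈ (no w∉Y) = inj₂ (toward-W W-nested X∈ v∉X v∈W together Y∈ w∈W w∉Y)

  -- If some `Y` separates `X` from `X′`, go through its hub. If none does and the hubs differ, the
  -- block at `X` around a vertex of `X′` is adjacent to both.
  hubs-joined : ∀ n {X X′} (X∈ : X ∈ 𝒩) (X′∈ : X′ ∈ 𝒩) →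
    CS.AtMost n (λ Z → Z ∈ 𝒩 × ¬ Together Z X X′) → Joined tree _~ᵀ_ (hub X X∈) (hub X′ X′∈)
  hubs-joined n {X} {X′} X∈ X′∈ at with apart-all {X} {X′}
  hubs-joined n {X} {X′} X∈ X′∈ at | inj₂ (Y , Y∈ , ¬t) with closer (nested X′∈) X∈ Y∈ ¬t at
  ... | m , refl , at , at′ = hubs-joined m X∈ Y∈ at ◅◅ hubs-joined m Y∈ X′∈ at′
  hubs-joined n {X} {X′} X∈ X′∈ at | inj₁ together with em {P = X′ ⊆ X}
  ... | yes X′⊆X = inj₁ (hub-cong (equal X′∈ X∈ X′⊆X , X′⊆X)) ◅ ε
  ... | no X′⊈X with v , v∈X′ , v∉X ← ⊈⇒∃ X′⊈X =
    inj₂ (~ᵀ-sym (block~hub X∈ v∉X)) ◅ inj₂ (record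
      { kinds = λ ()
      ; agree = λ { Y∈ u∈ (x , x∈ , x∉ , xw) →
          dir-conn {s = block X X∈ v v∉X} Y∈ u∈ (toward-W (nested X′∈) X∈ v∉X v∈X′ together Y∈ x∈ x∉) ◅◅ xw } }) ◅ ε

  tree-connected : ∀ s t → Joined tree _~ᵀ_ s t
  tree-connected s t = let X , X∈ , sX = reach-hub s ; Y , Y∈ , tY = reach-hub t in
    sX ◅◅ joined X∈ Y∈ ◅◅ joined-sym tY
    where
    joined-sym : ∀ {s t} → Joined tree _~ᵀ_ s t → Joined tree _~ᵀ_ t s
    joined-sym = reverse λ { (inj₁ e) → inj₁ (≈ᵀ-sym e) ; (inj₂ a) → inj₂ (~ᵀ-sym a) }
    reach-hub : ∀ s → ∃₂ λ X X∈ → Joined tree _~ᵀ_ s (hub X X∈)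
    reach-hub (hub X X∈) = X , X∈ , ε
    reach-hub (block X X∈ v v∉X) = X , X∈ , inj₂ (block~hub X∈ v∉X) ◅ ε
    joined : ∀ {X Y} (X∈ : X ∈ 𝒩) (Y∈ : Y ∈ 𝒩) → Joined tree _~ᵀ_ (hub X X∈) (hub Y Y∈)
    joined X∈ Y∈ = hubs-joined _ X∈ Y∈ (proj₂ (CS.finite-⊆ (λ (Z∈ , ¬t) → tight Z∈ , ¬t)
      (apart-finite (_ , CV.hasSize⇒atMost (size (tight X∈))) (_ , CV.hasSize⇒atMost (size (tight Y∈))))))

  -- Acyclicity and the behaviour of paths

  ≁ᵀ-kind : ∀ {s t} → s ~ᵀ t → isHub s ≡ false → isHub t ≡ true
  ≁ᵀ-kind {s} {t} s~t s-block with isHub t in eq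
  ... | true  = refl
  ... | false = contradiction (trans s-block (sym eq)) (kinds s~t)

  hub-or-block : ∀ s → isHub s ≡ true ⊎ isHub s ≡ false
  hub-or-block (hub _ _)       = inj₁ refl
  hub-or-block (block _ _ _ _) = inj₂ refl

  -- If f 0 or f 1 is the hub X, then all other nodes of the cycle lie in the same direction from X.
  tree-acyclic : ∀ {n} (f : Fin (3 + n) → Node) → ¬ IsCycle tree f
  tree-acyclic {n} f (path , closing) with hub-or-block (f zero)
  ... | inj₁ f₀-hub = hub-first (hub-view f₀-hub)
    where
    open IsPath path
    hub-first : ¬ (∃₂ λ X X∈ → f zero ≈ᵀ hub X X∈)
    hub-first (X , X∈ , f₀≈) =
      contradiction (distinct {suc zero} {fromℕ (2 + n)} (same-block f₁~ last~ w∈ (all (fromℕ (suc n))))) λ ()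
      where
      f₁~ : f (suc zero) ~ᵀ hub X X∈
      f₁~ = ~ᵀ-respʳ f₀≈ (~ᵀ-sym (step zero))
      last~ : f (fromℕ (2 + n)) ~ᵀ hub X X∈
      last~ = ~ᵀ-respʳ f₀≈ closing
      inside : ∃[ w ] w ∈ dir X (f (suc zero))
      inside = block-inhabited (block-next-to-hub f₁~)
      w : V
      w = proj₁ inside
      w∈ : w ∈ dir X (f (suc zero))
      w∈ = proj₂ inside
      next : ∀ i → w ∈ dir X (f (suc (inject₁ i))) → w ∈ dir X (f (suc (suc i)))
      next i w∈i with cross-edge X∈ (step (suc i)) w∈i
      ... | inj₁ w∈ = w∈
      ... | inj₂ e with () ← distinct {suc (suc i)} {zero} (≈ᵀ-trans e (≈ᵀ-sym f₀≈))
      all : ∀ i → w ∈ dir X (f (suc i))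
      all = <-weakInduction (λ i → w ∈ dir X (f (suc i))) w∈ next
  ... | inj₂ f₀-block = hub-second (hub-view (≁ᵀ-kind (IsPath.step path zero) f₀-block))
    where
    open IsPath path
    hub-second : ¬ (∃₂ λ X X∈ → f (suc zero) ≈ᵀ hub X X∈)
    hub-second (X , X∈ , f₁≈) = wrap-around (cross-edge X∈ closing (all (fromℕ n)))
      where
      f₂~ : f (suc (suc zero)) ~ᵀ hub X X∈
      f₂~ = ~ᵀ-respʳ f₁≈ (~ᵀ-sym (step (suc zero)))
      inside : ∃[ w ] w ∈ dir X (f (suc (suc zero)))
      inside = block-inhabited (block-next-to-hub f₂~)
      w : V
      w = proj₁ inside
      next : ∀ i → w ∈ dir X (f (suc (suc (inject₁ i)))) → w ∈ dir X (f (suc (suc (suc i))))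
      next i w∈i with cross-edge X∈ (step (suc (suc i))) w∈i
      ... | inj₁ w∈ = w∈
      ... | inj₂ e with () ← distinct {suc (suc (suc i))} {suc zero} (≈ᵀ-trans e (≈ᵀ-sym f₁≈))
      all : ∀ i → w ∈ dir X (f (suc (suc i)))
      all = <-weakInduction (λ i → w ∈ dir X (f (suc (suc i)))) (proj₂ inside) next
      wrap-around : ¬ (w ∈ dir X (f zero) ⊎ f zero ≈ᵀ hub X X∈)
      wrap-around (inj₁ w∈₀) = contradiction
        (distinct {zero} {suc (suc zero)} (same-block (~ᵀ-respʳ f₁≈ (step zero)) f₂~ w∈₀ (proj₂ inside))) λ ()
      wrap-around (inj₂ e) = contradiction (distinct {zero} {suc zero} (≈ᵀ-trans e (≈ᵀ-sym f₁≈))) λ ()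

  -- A path leaving the component containing v passes through the hub X, and so does a path coming back.
  path-convex : ∀ {n} (f : Fin (suc n) → Node) → IsPath tree f → ∀ {X v} → X ∈ 𝒩 →
    v ∈ dir X (f zero) → v ∈ dir X (f (fromℕ n)) → ∀ i → v ∈ dir X (f i)
  path-convex {n} f path {X} {v} X∈ v∈first v∈last i = decidable-stable em λ v∉ → impossible
    (decidable-stable em λ none → v∉ (<-weakInduction (λ i → v ∈ dir X (f i)) v∈first
      (λ j v∈ → decidable-stable em λ v∉ → none (j , v∈ , v∉)) i))
    (decidable-stable em λ none → v∉ (>-weakInduction (λ i → v ∈ dir X (f i)) v∈last
      (λ j v∈ → decidable-stable em λ v∉ → none (j , v∈ , v∉)) i))
    where
    open IsPath path
    at-hub : ∀ {s t} → s ~ᵀ t → v ∈ dir X s → v ∉ dir X t → t ≈ᵀ hub X X∈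
    at-hub s~t v∈s v∉t with cross-edge X∈ s~t v∈s
    ... | inj₁ v∈t = contradiction v∈t v∉t
    ... | inj₂ e   = e
    crossed : ∀ (i j : Fin n) → suc i ≡ inject₁ j → inject₁ i ≢ suc j
    crossed i j si≡j i≡sj
      with p ← cong toℕ si≡j | q ← cong toℕ i≡sj
      rewrite toℕ-inject₁ i | toℕ-inject₁ j | q = m≢1+n+m _ (sym p)
    impossible : (∃[ i ] v ∈ dir X (f (inject₁ i)) × v ∉ dir X (f (suc i))) →
      ¬ (∃[ j ] v ∈ dir X (f (suc j)) × v ∉ dir X (f (inject₁ j)))
    -- The hub `X` is visited once, so the exit at step `i` ends where the return at step `j`
    -- begins. The blocks before and after agree by `same-block`, which makes both `i + 1 = j` and
    -- `i = j + 1`.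
    impossible (i , v∈i , v∉i) (j , v∈j , v∉j) = crossed i j (distinct (≈ᵀ-trans hubᵢ (≈ᵀ-sym hubⱼ)))
      (distinct (same-block (~ᵀ-respʳ hubᵢ (step i)) (~ᵀ-respʳ hubⱼ (~ᵀ-sym (step j))) v∈i v∈j))
      where
      hubᵢ : f (suc i) ≈ᵀ hub X X∈
      hubᵢ = at-hub (step i) v∈i v∉i
      hubⱼ : f (inject₁ j) ≈ᵀ hub X X∈
      hubⱼ = at-hub (~ᵀ-sym (step j)) v∈j v∉j

  -- The axioms of a tree-decomposition and the adhesion sets

  part-resp : ∀ s → part s Respects _≈_
  part-resp s u≈v u∈ Y∈ with u∈ Y∈
  ... | inj₁ u∈Y = inj₁ (resp (tight Y∈) u≈v u∈Y)
  ... | inj₂ u∈dir = inj₂ (dir-closed {s = s} u∈dir (conn-≈ u≈v))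

  module _ {u v : V} (uv : u ≈ v ⊎ u ~ v) where
    private
      Ends : Pred V ℓ
      Ends x = x ≈ u ⊎ x ≈ v

      linked : ∀ {Y} → Y ∈ 𝒩 → u ∉ Y → v ∉ Y → u ≈ v ⊎ u ~ v → Conn Y u v
      linked Y∈ u∉ v∉ (inj₁ u≈v) = conn-≈ u≈v
      linked Y∈ u∉ v∉ (inj₂ u~v) = inj₂ (u~v , u∉ , v∉) ◅ ε

      ends-nested : ∀ {Y} → Y ∈ 𝒩 → Nested Ends Y
      ends-nested Y∈ (inj₁ x≈u) _ (inj₁ y≈u) _ = conn-≈ (V.trans x≈u (V.sym y≈u))
      ends-nested Y∈ (inj₂ x≈v) _ (inj₂ y≈v) _ = conn-≈ (V.trans x≈v (V.sym y≈v))
      ends-nested Y∈ (inj₁ x≈u) x∉ (inj₂ y≈v) y∉ =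
        conn-≈ x≈u ◅◅ linked Y∈ (x∉ ∘ resp (tight Y∈) (V.sym x≈u)) (y∉ ∘ resp (tight Y∈) (V.sym y≈v)) uv ◅◅
        conn-≈ (V.sym y≈v)
      ends-nested Y∈ (inj₂ x≈v) x∉ (inj₁ y≈u) y∉ = conn-sym
        (conn-≈ y≈u ◅◅ linked Y∈ (y∉ ∘ resp (tight Y∈) (V.sym y≈u)) (x∉ ∘ resp (tight Y∈) (V.sym x≈v)) uv ◅◅
         conn-≈ (V.sym x≈v))

    -- No set separates the ends of an edge, so `contained` applies to them. The alternative `u ≈ v`
    -- serves to place a single vertex.
    common-part : ∃[ s ] u ∈ part s × v ∈ part s
    common-part = let s , ends⊆ = contained ends-nested (CV.finite-∪ (CV.finite-singleton u) (CV.finite-singleton v))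
                  in s , ends⊆ (inj₁ V.refl) , ends⊆ (inj₂ V.refl)

  decomposition : TreeDecomposition G (lsuc ℓ)
  decomposition = record
    { T         = tree
    ; isTree    = record { node = hub _ (proj₂ inhabited) ; connected = tree-connected ; acyclic = tree-acyclic }
    ; part      = part
    ; node-resp = λ e → (λ v∈ {Y} Y∈ → move Y (dirs e Y∈) (v∈ Y∈)) , λ v∈ {Y} Y∈ → move Y (swap (dirs e Y∈)) (v∈ Y∈)
    ; part-resp = part-resp
    ; vertices  = λ v → let s , v∈ , _ = common-part (inj₁ (V.refl {v})) in s , v∈
    ; edges     = λ u~v → common-part (inj₂ u~v)
    ; paths     = λ f path i (v∈first , v∈last) Y∈ → convex f path i Y∈ (v∈first Y∈) (v∈last Y∈)
    }
    where
    move : ∀ Y {D E : Pred V ℓ} {v} → D ≐ E → v ∈ Y ⊎ v ∈ D → v ∈ Y ⊎ v ∈ E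
    move Y D≐E (inj₁ v∈Y) = inj₁ v∈Y
    move Y D≐E (inj₂ v∈D) = inj₂ (proj₁ D≐E v∈D)
    convex : ∀ {n} (f : Fin (suc n) → Node) → IsPath tree f → ∀ i {Y v} → Y ∈ 𝒩 →
      v ∈ Y ⊎ v ∈ dir Y (f zero) → v ∈ Y ⊎ v ∈ dir Y (f (fromℕ n)) → v ∈ Y ⊎ v ∈ dir Y (f i)
    convex f path i Y∈ (inj₁ v∈Y) _ = inj₁ v∈Y
    convex f path i Y∈ (inj₂ _) (inj₁ v∈Y) = inj₁ v∈Y
    convex f path i Y∈ (inj₂ v∈first) (inj₂ v∈last) = inj₂ (path-convex f path Y∈ v∈first v∈last i)

  hub-edge⊆part : ∀ {X X∈ s} → s ~ᵀ hub X X∈ → X ⊆ part s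
  hub-edge⊆part {X} {X∈} {s} s~ {x} x∈X {Y} Y∈ with em {P = x ∈ Y}
  ... | yes x∈Y = inj₁ x∈Y
  ... | no x∉Y with cross-edge {w = x} Y∈ (~ᵀ-sym s~) (x , x∈X , x∉Y , ε)
  ...   | inj₁ x∈dir = inj₂ x∈dir
  ...   | inj₂ s≈hub = contradiction (kind s≈hub) (kinds s~)

  adhesion : ∀ {X X∈ s t} → s ≈ᵀ hub X X∈ → s ~ᵀ t → X ≐ part s ∩ part t
  adhesion {X} {X∈} s≈ s~t =
    (λ x∈X → proj₂ (TreeDecomposition.node-resp decomposition s≈) (hub⊆part {X∈ = X∈} x∈X) ,
             hub-edge⊆part (~ᵀ-respʳ s≈ (~ᵀ-sym s~t)) x∈X) ,
    (λ (x∈s , _) → part⊆hub {X∈ = X∈} (proj₁ (TreeDecomposition.node-resp decomposition s≈) x∈s))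

  decomposition-balanced : IsBalanced decomposition k
  decomposition-balanced {s} {t} s~t with hub-or-block s
  ... | inj₁ s-hub = let X , X∈ , s≈ = hub-view s-hub in
    CV.hasSize-≐ (adhesion s≈ s~t) (size (tight X∈))
  ... | inj₂ s-block = let X , X∈ , t≈ = hub-view (≁ᵀ-kind s~t s-block) in
    CV.hasSize-≐ ((λ x∈X → swap (proj₁ (adhesion t≈ (~ᵀ-sym s~t)) x∈X)) ,
                  λ x∈ → proj₂ (adhesion t≈ (~ᵀ-sym s~t)) (swap x∈)) (size (tight X∈))

  -- The separation induced by an edge

  module _ {X} (X∈ : X ∈ 𝒩) {b} (b~ : b ~ᵀ hub X X∈) where
    private
      h : Node
      h = hub X X∈

      OffHub : Node → Node → Set (lsuc ℓ)
      OffHub = AvoidingVertices tree (_≈ᵀ h)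

      -- Follow the walk up to its first arrival at the hub. Until then `cross-edge` keeps `v` in
      -- the direction of every node, so none of them is the hub, and the last one is the neighbour
      -- `c`.
      offHub-joined : ∀ {s v} → v ∈ dir X s → Joined tree _~ᵀ_ s h →
        ∃[ c ] c ~ᵀ h × v ∈ dir X c × Joined tree OffHub c s
      offHub-joined v∈ ε = contradiction v∈ (hub-empty {X∈ = X∈} ≈ᵀ-refl)
      offHub-joined v∈ (inj₁ e ◅ path) =
        let c , c~ , v∈c , cs = offHub-joined (proj₁ (dirs e X∈) v∈) path in c , c~ , v∈c , cs ◅◅ inj₁ (≈ᵀ-sym e) ◅ ε
      offHub-joined {s} v∈ (_◅_ {j = t} (inj₂ s~t) path) with cross-edge X∈ s~t v∈
      ... | inj₂ t≈h = s , ~ᵀ-respʳ t≈h s~t , v∈ , ε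
      ... | inj₁ v∈t = let c , c~ , v∈c , ct = offHub-joined v∈t path in
        c , c~ , v∈c , ct ◅◅ inj₂ (~ᵀ-sym s~t , (λ e → hub-empty e v∈t) , λ e → hub-empty e v∈) ◅ ε

      toward-vertex : ∀ {v} → v ∉ X →
        ∃₂ λ s c → v ∈ part s × c ~ᵀ h × v ∈ dir X c × Joined tree OffHub c s
      toward-vertex {v} v∉X with s , v∈s ← TreeDecomposition.vertices decomposition v with v∈s X∈
      ... | inj₁ v∈X = contradiction v∈X v∉X
      ... | inj₂ v∈dir = let c , c~ , v∈c , cs = offHub-joined v∈dir (tree-connected s h) in s , c , v∈s , c~ , v∈c , cs

      -- The walk could leave the direction of `b` only by entering the hub from a neighbour in that
      -- direction. This neighbour is `b`, so the step would use the forbidden edge.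
      stays : ∀ {s t u} → u ∈ dir X b → u ∈ dir X s → Joined tree (AvoidingEdge tree b h) s t → u ∈ dir X t
      stays u∈b u∈s ε = u∈s
      stays u∈b u∈s (inj₁ e ◅ path) = stays u∈b (proj₁ (dirs e X∈) u∈s) path
      stays u∈b u∈s (inj₂ (s~t , ≢bh , _) ◅ path) with cross-edge X∈ s~t u∈s
      ... | inj₁ u∈t = stays u∈b u∈t path
      ... | inj₂ t≈h = contradiction (same-block (~ᵀ-respʳ t≈h s~t) b~ u∈s u∈b , t≈h) ≢bh

      stays-away : ∀ {s t u} → u ∈ dir X b → u ∉ dir X s → Joined tree (AvoidingEdge tree h b) s t → u ∉ dir X t
      stays-away u∈b u∉s ε = u∉s
      stays-away u∈b u∉s (inj₁ e ◅ path) = stays-away u∈b (λ u∈ → u∉s (proj₂ (dirs e X∈) u∈)) path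
      stays-away {u = u} u∈b u∉s (_◅_ {j = t} (inj₂ (s~t , ≢hb , _)) path) = stays-away u∈b u∉t path
        where
        u∉t : u ∉ dir X t
        u∉t u∈t with cross-edge X∈ (~ᵀ-sym s~t) u∈t
        ... | inj₁ u∈s = u∉s u∈s
        ... | inj₂ s≈h = ≢hb (s≈h , same-block (~ᵀ-respʳ s≈h (~ᵀ-sym s~t)) b~ u∈t u∈b)

    block-side : X ∪ dir X b ≐ Side decomposition b h
    block-side = inward , outward
      where
      inward : X ∪ dir X b ⊆ Side decomposition b h
      inward (inj₁ v∈X) = b , ε , hub-edge⊆part b~ v∈X
      inward (inj₂ v∈b) with s , c , v∈s , c~ , v∈c , cs ← toward-vertex (dir-outside {s = b} X∈ v∈b) =
        s , inj₁ (same-block b~ c~ v∈b v∈c) ◅ mapStar avoid cs , v∈s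
        where
        avoid : ∀ {s t} → s ≈ᵀ t ⊎ OffHub s t → s ≈ᵀ t ⊎ AvoidingEdge tree b h s t
        avoid (inj₁ e) = inj₁ e
        avoid (inj₂ (s~t , s≉h , t≉h)) = inj₂ (s~t , (λ (_ , t≈h) → t≉h t≈h) , λ (s≈h , _) → s≉h s≈h)
      outward : Side decomposition b h ⊆ X ∪ dir X b
      outward (s , bs , v∈s) with v∈s X∈
      ... | inj₁ v∈X = inj₁ v∈X
      ... | inj₂ v∈dir = let u , u∈ = block-inhabited (block-next-to-hub b~)
                         in inj₂ (proj₁ (dir-meet {s = s} {b} X∈ (stays u∈ u∈ bs) u∈) v∈dir)

    -- A vertex outside `X` and outside the direction of `b` lies behind another neighbour `c` of
    -- the hub, which is reached without the edge to `b`.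
    hub-side : ∁ (dir X b) ≐ Side decomposition h b
    hub-side = inward , outward
      where
      inward : ∁ (dir X b) ⊆ Side decomposition h b
      inward {v} v∉b with em {P = v ∈ X}
      ... | yes v∈X = h , ε , hub⊆part {X∈ = X∈} v∈X
      ... | no v∉X with s , c , v∈s , c~ , v∈c , cs ← toward-vertex v∉X =
        s , inj₂ (~ᵀ-sym c~ , (λ (_ , c≈b) → v∉b (proj₁ (dirs c≈b X∈) v∈c)) , λ (_ , c≈h) → hub-empty c≈h v∈c) ◅
            mapStar avoid cs , v∈s
        where
        avoid : ∀ {s t} → s ≈ᵀ t ⊎ OffHub s t → s ≈ᵀ t ⊎ AvoidingEdge tree h b s t
        avoid (inj₁ e) = inj₁ e
        avoid (inj₂ (s~t , s≉h , t≉h)) = inj₂ (s~t , (λ (s≈h , _) → s≉h s≈h) , λ (_ , t≈h) → t≉h t≈h)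
      outward : Side decomposition h b ⊆ ∁ (dir X b)
      outward (s , hs , v∈s) v∈b with v∈s X∈
      ... | inj₁ v∈X = dir-outside {s = b} X∈ v∈b v∈X
      ... | inj₂ v∈dir = stays-away v∈b (hub-empty {X∈ = X∈} ≈ᵀ-refl) hs v∈dir

-- Invariance under isomorphisms

module Transport (em : ∀ {a} → ExcludedMiddle a) {ℓ : Level} where

  module _ {G G′ : Graph ℓ} (φ : G ≅ G′) where
    private
      module G  = Graph G
      module G′ = Graph G′
      module V  = Setoid G.vertices
      module V′ = Setoid G′.vertices
    open _≅_ φ
    open Inverse inverse using (to-cong; from-cong; strictlyInverseˡ; strictlyInverseʳ)

    flip : G′ ≅ G
    flip = record
      { inverse  = Symmetry.inverse inverse
      ; adjacent = λ {u} {v} → mk⇔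
          (λ u~v → Equivalence.from adjacent
            (proj₂ G′.~-resp-≈ (V′.sym (strictlyInverseˡ u)) (proj₁ G′.~-resp-≈ (V′.sym (strictlyInverseˡ v)) u~v)))
          (λ u~v → proj₂ G′.~-resp-≈ (strictlyInverseˡ u) (proj₁ G′.~-resp-≈ (strictlyInverseˡ v)
            (Equivalence.to adjacent u~v)))
      }

    -- `maps` speaks only of vertices `to v`. Since both sets respect equality, it extends to every
    -- vertex of `G′` and can be reversed.
    record _↦_ (X : Pred G.V ℓ) (X′ : Pred G′.V ℓ) : Set ℓ where
      field
        resp  : X Respects G._≈_
        resp′ : X′ Respects G′._≈_
        maps  : MapsSet φ X X′

      push : ∀ {v} → v ∈ X → to v ∈ X′
      push {v} = Equivalence.to (maps v)

      pull : ∀ {v} → to v ∈ X′ → v ∈ X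
      pull {v} = Equivalence.from (maps v)

      pull′ : ∀ {v} → v ∈ X′ → from v ∈ X
      pull′ {v} v∈ = pull (resp′ (V′.sym (strictlyInverseˡ v)) v∈)

    open _↦_

    image : Pred G.V ℓ → Pred G′.V ℓ
    image X = X ∘ from

    ↦-image : ∀ {X} → X Respects G._≈_ → X ↦ image X
    ↦-image X-resp = record
      { resp  = X-resp
      ; resp′ = λ u≈v → X-resp (from-cong u≈v)
      ; maps  = λ v → mk⇔ (X-resp (V.sym (strictlyInverseʳ v))) (X-resp (strictlyInverseʳ v))
      }

    hasSize-map : ∀ {X X′ n} → X ↦ X′ → HasSize G.vertices X n → HasSize G′.vertices X′ n
    hasSize-map X↦X′ size = record
      { to = λ i → to (proj₁ (Bijection.to size i)) , push X↦X′ (proj₂ (Bijection.to size i))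
      ; cong = λ { refl → V′.refl }
      ; bijective = (λ {i} {j} eq → Bijection.injective size
            (V.trans (V.sym (strictlyInverseʳ _)) (V.trans (from-cong eq) (strictlyInverseʳ _))))
        , λ (y , y∈) → let i , eq = Bijection.strictlySurjective size (from y , pull′ X↦X′ y∈) in
            i , λ { refl → V′.trans (to-cong eq) (strictlyInverseˡ y) }
      }

    conn-map : ∀ {X X′ u v} → X ↦ X′ → Separators.Conn em G X u v → Separators.Conn em G′ X′ (to u) (to v)
    conn-map X↦X′ = gmap to λ
      { (inj₁ u≈v) → inj₁ (to-cong u≈v)
      ; (inj₂ (u~v , u∉ , v∉)) → inj₂ (Equivalence.to adjacent u~v , u∉ ∘ pull X↦X′ , v∉ ∘ pull X↦X′) }

    imageSeparation : Separation G → Separation G′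
    imageSeparation S = record
      { A      = image (A S)
      ; B      = image (B S)
      ; A-resp = A-resp S ∘ from-cong
      ; B-resp = B-resp S ∘ from-cong
      ; cover  = λ v → cover S (from v)
      ; noEdge = λ u∈ v∈ u~v → noEdge S u∈ v∈ (Equivalence.to (_≅_.adjacent flip) u~v)
      }
      where open Separation

    maps-imageSeparation : ∀ S → MapsSeparation φ S (imageSeparation S)
    maps-imageSeparation S = maps (↦-image (Separation.A-resp S)) , maps (↦-image (Separation.B-resp S))

    record _⟼_ (P : Profile G) (P′ : Profile G′) : Set (lsuc ℓ) where
      constructor mapping
      field
        mapsProfile : MapsProfile φ P P′

      push-member : ∀ {S S′} → MapsSeparation φ S S′ → S ∈ᵖ P → S′ ∈ᵖ P′
      push-member {S} {S′} m = Equivalence.to (mapsProfile {S} {S′} m)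

      pull-member : ∀ {S S′} → MapsSeparation φ S S′ → S′ ∈ᵖ P′ → S ∈ᵖ P
      pull-member {S} {S′} m = Equivalence.from (mapsProfile {S} {S′} m)

    open _⟼_

    distinguishes-map : ∀ {S P P′ Q Q′} → P ⟼ Q → P′ ⟼ Q′ →
      Distinguishes S P P′ → Distinguishes (imageSeparation S) Q Q′
    distinguishes-map {S} mP mP′ (inj₁ (S∈ , S⁻∈)) =
      inj₁ (push-member mP {S} {imageSeparation S} (maps-imageSeparation S) S∈ ,
            push-member mP′ {S ⁻} {imageSeparation S ⁻} (swap (maps-imageSeparation S)) S⁻∈)
    distinguishes-map {S} mP mP′ (inj₂ (S⁻∈ , S∈)) =
      inj₂ (push-member mP {S ⁻} {imageSeparation S ⁻} (swap (maps-imageSeparation S)) S⁻∈ ,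
            push-member mP′ {S} {imageSeparation S} (maps-imageSeparation S) S∈)

    sep-map : ∀ {𝒫 : Pred (Profile G) (lsuc ℓ)} {𝒫′ : Pred (Profile G′) (lsuc ℓ)} {k P P′ Q Q′ X X′} →
      P ⟼ Q → P′ ⟼ Q′ → X ↦ X′ → Profiles.Sep em G 𝒫 k P P′ X → Profiles.Sep em G′ 𝒫′ k Q Q′ X′
    sep-map {𝒫} {k = k} mP mP′ X↦X′ (Profiles.sepBy S order (S⊆X , X⊆S) dist) =
      Profiles.sepBy (imageSeparation S) (hasSize-map (↦-image (Profiles.separator-resp em G 𝒫 k S)) order)
        ((λ v∈ → resp′ X↦X′ (strictlyInverseˡ _) (push X↦X′ (S⊆X v∈))) , λ v∈ → X⊆S (pull′ X↦X′ v∈))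
        (distinguishes-map {S} mP mP′ dist)

  module _ {G G′ : Graph ℓ} (φ : G ≅ G′) where
    private
      module G  = Graph G
      module G′ = Graph G′
    open _≅_ φ
    open Inverse inverse using (to-cong; from-cong; strictlyInverseˡ; strictlyInverseʳ)
    open _↦_

    ↦-flip : ∀ {X X′} → _↦_ φ X X′ → _↦_ (flip φ) X′ X
    ↦-flip m = record
      { resp = resp′ m ; resp′ = resp m
      ; maps = λ v → mk⇔ (pull′ m) λ v∈ → resp′ m (strictlyInverseˡ v) (push m v∈) }

    -- Separate from `↦-flip` because `flip (flip φ)` and `φ` carry different adjacency proofs.
    ↦-unflip : ∀ {X X′} → _↦_ (flip φ) X′ X → _↦_ φ X X′
    ↦-unflip m = record
      { resp = resp′ m ; resp′ = resp m
      ; maps = λ v → mk⇔ (pull′ m) λ v∈ → resp′ m (strictlyInverseʳ v) (push m v∈) }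

    ⟼-flip : ∀ {P P′} → _⟼_ φ P P′ → _⟼_ (flip φ) P′ P
    ⟼-flip mP = mapping λ {S′} {S} (mA , mB) →
      let m : MapsSeparation φ S S′
          m = maps (↦-unflip record { resp = A-resp S′ ; resp′ = A-resp S ; maps = mA })
            , maps (↦-unflip record { resp = B-resp S′ ; resp′ = B-resp S ; maps = mB })
      in mk⇔ (_⟼_.pull-member mP {S} {S′} m) (_⟼_.push-member mP {S} {S′} m)
      where open Separation

    carry : ∀ {𝒫 : Pred (Profile G) (lsuc ℓ)} {𝒫′ : Pred (Profile G′) (lsuc ℓ)} → MapsOnto φ 𝒫 𝒫′ →
      ∀ {P} → P ∈ 𝒫 → ∃[ Q ] Q ∈ 𝒫′ × _⟼_ φ P Q
    carry (onto , _) P∈ = let Q , Q∈ , mP = onto P∈ in Q , Q∈ , mapping λ {S} {S′} → mP {S} {S′}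

    mapsOnto-flip : ∀ {𝒫 : Pred (Profile G) (lsuc ℓ)} {𝒫′ : Pred (Profile G′) (lsuc ℓ)} →
      MapsOnto φ 𝒫 𝒫′ → MapsOnto (flip φ) 𝒫′ 𝒫
    mapsOnto-flip (onto , onto′) =
      (λ {P′} P′∈ → let P , P∈ , mP = onto′ P′∈ in P , P∈ , back {P} {P′} (mapping λ {S} {S′} → mP {S} {S′})) ,
      (λ {P} P∈ → let P′ , P′∈ , mP = onto P∈ in P′ , P′∈ , back {P} {P′} (mapping λ {S} {S′} → mP {S} {S′}))
      where
      back : ∀ {P P′} → _⟼_ φ P P′ → MapsProfile (flip φ) P′ P
      back mP {S′} {S} = _⟼_.mapsProfile (⟼-flip mP) {S′} {S}

    conn-reflect : ∀ {X X′ u v} → _↦_ φ X X′ →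
      Separators.Conn em G′ X′ (to u) (to v) → Separators.Conn em G X u v
    conn-reflect m c = conn-≈ (V.sym (strictlyInverseʳ _)) ◅◅ conn-map (flip φ) (↦-flip m) c ◅◅
      conn-≈ (strictlyInverseʳ _)
      where
      open Separators em G
      module V = Setoid G.vertices

    module _ {𝒫 : Pred (Profile G) (lsuc ℓ)} {𝒫′ : Pred (Profile G′) (lsuc ℓ)} (onto : MapsOnto φ 𝒫 𝒫′) where
      κ-least : ∀ {k k′} → Isκ 𝒫 k → Isκ 𝒫′ k′ → k′ ≤ k
      κ-least {k} isκ isκ′ =
        let S , order , P , P′ , P∈ , P′∈ , dist = Isκ.attained isκ
            Q , Q∈ , mP = carry onto P∈
            Q′ , Q′∈ , mP′ = carry onto P′∈
        in Isκ.minimal isκ′ {imageSeparation φ S}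
             (Q , Q′ , Q∈ , Q′∈ , distinguishes-map φ {S} mP mP′ dist)
             (hasSize-map φ (↦-image φ (Profiles.separator-resp em G 𝒫 k S)) order)

      crossing-map : ∀ {k X X′ Z Z′} → _↦_ φ X X′ → _↦_ φ Z Z′ →
        Profiles.Crossing em G 𝒫 k X Z → Profiles.Crossing em G′ 𝒫′ k X′ Z′
      crossing-map X↦X′ Z↦Z′ ((P , P′ , P∈ , P′∈ , s) , cross) =
        let Q , Q∈ , mP = carry onto P∈
            Q′ , Q′∈ , mP′ = carry onto P′∈
        in (Q , Q′ , Q∈ , Q′∈ , sep-map φ mP mP′ Z↦Z′ s) ,
           λ nested → cross λ x∈ x∉ y∈ y∉ → conn-reflect Z↦Z′
             (nested (push X↦X′ x∈) (x∉ ∘ pull Z↦Z′) (push X↦X′ y∈) (y∉ ∘ pull Z↦Z′))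

  module _ {G G′ : Graph ℓ} (φ : G ≅ G′) {𝒫 : Pred (Profile G) (lsuc ℓ)} {𝒫′ : Pred (Profile G′) (lsuc ℓ)}
    (onto : MapsOnto φ 𝒫 𝒫′) where
    open _≅_ φ
    private
      module G  = Graph G
      module G′ = Graph G′
      module CS  = Counting em (≐-setoid G.V ℓ)
      module CS′ = Counting em (≐-setoid G′.V ℓ)
      module V′ = Setoid G′.vertices
      onto⁻¹ = mapsOnto-flip φ onto
    open Inverse inverse using (strictlyInverseˡ)

    κ-equal : ∀ {k k′} → Isκ 𝒫 k → Isκ 𝒫′ k′ → k ≡ k′
    κ-equal isκ isκ′ = ≤-antisym (κ-least (flip φ) onto⁻¹ isκ′ isκ) (κ-least φ onto isκ isκ′)

    -- A set crossing `X′` is pulled back, found in the given list up to `_≐_`, and pushed forward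
    -- again.
    covered-map : ∀ {k n X X′} → _↦_ φ X X′ →
      CS.AtMost n (Profiles.Crossing em G 𝒫 k X) → CS′.AtMost n (Profiles.Crossing em G′ 𝒫′ k X′)
    covered-map {k} X↦X′ (Zs , len , cov) =
      mapList (image φ) Zs , ≤-trans (≤-reflexive (length-map (image φ) Zs)) len ,
      λ crossing@((_ , _ , _ , _ , s) , _) → let Z′-resp = Profiles.sep-resp em G′ 𝒫′ k s in
        Any-map⁺ (mapAny (shift Z′-resp) (cov (crossing-map (flip φ) onto⁻¹ (↦-flip φ X↦X′)
          (↦-image (flip φ) Z′-resp) crossing)))
      where
      shift : ∀ {Z′ W} → Z′ Respects G′._≈_ → image (flip φ) Z′ ≐ W → Z′ ≐ image φ W
      shift Z′-resp (⊆W , W⊆) =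
        (λ v∈ → ⊆W (Z′-resp (V′.sym (strictlyInverseˡ _)) v∈)) , λ v∈ → Z′-resp (strictlyInverseˡ _) (W⊆ v∈)

  module _ {G G′ : Graph ℓ} (φ : G ≅ G′) {𝒫 : Pred (Profile G) (lsuc ℓ)} {𝒫′ : Pred (Profile G′) (lsuc ℓ)}
    (onto : MapsOnto φ 𝒫 𝒫′) where

    -- The crossing bound is pushed along `φ`, while each competitor of `X′` is pulled back along
    -- `flip φ` to a competitor of `X` with the same bound.
    𝒩-map : ∀ {k X X′} → _↦_ φ X X′ → X ∈ Profiles.𝒩 em G 𝒫 k → X′ ∈ Profiles.𝒩 em G′ 𝒫′ k
    𝒩-map {k} X↦X′ (P , P′ , P∈ , P′∈ , n , s , covered , least) =
      let Q , Q∈ , mP = carry φ onto P∈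
          Q′ , Q′∈ , mP′ = carry φ onto P′∈
      in Q , Q′ , Q∈ , Q′∈ , n , sep-map φ mP mP′ X↦X′ s , covered-map φ onto X↦X′ covered ,
         λ s′ covered′ → let Y′↦Y = ↦-image (flip φ) (Profiles.sep-resp em G′ 𝒫′ k s′) in
           least (sep-map (flip φ) (⟼-flip φ mP) (⟼-flip φ mP′) Y′↦Y s′)
                 (covered-map (flip φ) (mapsOnto-flip φ onto) Y′↦Y covered′)

  -- The isomorphism between the trees

  module _ {G G′ : Graph ℓ} (φ : G ≅ G′)
    {𝒩 : Pred (Pred (Graph.V G) ℓ) (lsuc ℓ)} {𝒩′ : Pred (Pred (Graph.V G′) ℓ) (lsuc ℓ)} where
    private
      module G  = Graph G
      module G′ = Graph G′
      module T  = Nodes em G 𝒩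
      module T′ = Nodes em G′ 𝒩′
    open _≅_ φ
    open Inverse inverse using (to-cong; strictlyInverseˡ; strictlyInverseʳ)
    open _↦_
    open Separators em using (conn-≈)

    -- A relation rather than a map on nodes, so that it can be read backwards along `flip φ` and
    -- `dir-map` serves both ways.
    data _⇝_ : T.Node → T′.Node → Set (lsuc ℓ) where
      hub   : ∀ {X X′ X∈ X′∈} → _↦_ φ X X′ → T.hub X X∈ ⇝ T′.hub X′ X′∈
      block : ∀ {X X′ X∈ X′∈ v v′ v∉ v′∉} → _↦_ φ X X′ → to v G′.≈ v′ → T.block X X∈ v v∉ ⇝ T′.block X′ X′∈ v′ v′∉

    ⇝-kind : ∀ {s s′} → s ⇝ s′ → T.isHub s ≡ T′.isHub s′
    ⇝-kind (hub _)     = refl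
    ⇝-kind (block _ _) = refl

    dir-map : ∀ {Y Y′ s s′ w} → _↦_ φ Y Y′ → s ⇝ s′ → w ∈ T.dir Y s → to w ∈ T′.dir Y′ s′
    dir-map {Y} {Y′} Y↦Y′ = go
      where
      toward : ∀ {X X′ w} → _↦_ φ X X′ → w ∈ T.Toward Y X → to w ∈ T′.Toward Y′ X′
      toward m (x , x∈ , x∉ , xw) = to x , push m x∈ , x∉ ∘ pull Y↦Y′ , conn-map φ Y↦Y′ xw
      go : ∀ {s s′ w} → s ⇝ s′ → w ∈ T.dir Y s → to w ∈ T′.dir Y′ s′
      go (hub m) t = toward m t
      go (block m _) (inj₁ t) = inj₁ (toward m t)
      go (block m v≈v′) (inj₂ (X⊆Y , vw)) = inj₂
        ( (λ x∈ → resp′ Y↦Y′ (strictlyInverseˡ _) (push Y↦Y′ (X⊆Y (pull′ m x∈))))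
        , conn-≈ G′ (Setoid.sym G′.vertices v≈v′) ◅◅ conn-map φ Y↦Y′ vw )

  module _ {G G′ : Graph ℓ} (φ : G ≅ G′)
    {𝒩 : Pred (Pred (Graph.V G) ℓ) (lsuc ℓ)} {𝒩′ : Pred (Pred (Graph.V G′) ℓ) (lsuc ℓ)}
    (𝒩′-resp : ∀ {X} → X ∈ 𝒩′ → X Respects Graph._≈_ G′)
    (back : ∀ {X X′} → _↦_ (flip φ) X′ X → X′ ∈ 𝒩′ → X ∈ 𝒩) where
    private
      module G  = Graph G
      module G′ = Graph G′
      module T  = Nodes em G 𝒩
      module T′ = Nodes em G′ 𝒩′
    open _≅_ φ
    open Inverse inverse using (to-cong; from-cong; strictlyInverseˡ; strictlyInverseʳ)
    open _↦_

    ⇝-flip : ∀ {s s′} → _⇝_ φ {𝒩} {𝒩′} s s′ → _⇝_ (flip φ) {𝒩′} {𝒩} s′ s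
    ⇝-flip (hub m) = hub (↦-flip φ m)
    ⇝-flip (block m v≈v′) = block (↦-flip φ m)
      (Setoid.trans G.vertices (from-cong (Setoid.sym G′.vertices v≈v′)) (strictlyInverseʳ _))

    dir-pull : ∀ {Y Y′ s s′ w} → _↦_ φ Y Y′ → _⇝_ φ {𝒩} {𝒩′} s s′ → w ∈ T′.dir Y′ s′ → from w ∈ T.dir Y s
    dir-pull Y↦Y′ c w∈ = dir-map (flip φ) (↦-flip φ Y↦Y′) (⇝-flip c) w∈

    dir-push′ : ∀ {Y Y′ s s′ w} → _↦_ φ Y Y′ → _⇝_ φ {𝒩} {𝒩′} s s′ → from w ∈ T.dir Y s → w ∈ T′.dir Y′ s′
    dir-push′ {s′ = s′} Y↦Y′ c w∈ =
      T′.dir-closed {s = s′} (dir-map φ Y↦Y′ c w∈) (Separators.conn-≈ em G′ (strictlyInverseˡ _))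

    -- Equality and adjacency in the second tree quantify over `𝒩′`, and each of its members must be
    -- traced back to `𝒩` before the first tree can be used.
    preimage : ∀ {Y′} → Y′ ∈ 𝒩′ → ∃[ Y ] Y ∈ 𝒩 × _↦_ φ Y Y′
    preimage Y′∈ = let m = ↦-image (flip φ) (𝒩′-resp Y′∈) in _ , back m Y′∈ , ↦-unflip φ m

    ⇝-≈ : ∀ {s s′ t t′} → _⇝_ φ {𝒩} {𝒩′} s s′ → _⇝_ φ {𝒩} {𝒩′} t t′ → s T.≈ᵀ t → s′ T′.≈ᵀ t′
    ⇝-≈ {s} {s′} {t} {t′} c d e = record
      { kind = trans (sym (⇝-kind φ c)) (trans (T.kind e) (⇝-kind φ d))
      ; dirs = λ Y′∈ → let Y , Y∈ , m = preimage Y′∈ in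
          (λ w∈ → dir-push′ m d (proj₁ (T.dirs e Y∈) (dir-pull m c w∈))) ,
          (λ w∈ → dir-push′ m c (proj₂ (T.dirs e Y∈) (dir-pull m d w∈)))
      }

    ⇝-~ : ∀ {s s′ t t′} → _⇝_ φ {𝒩} {𝒩′} s s′ → _⇝_ φ {𝒩} {𝒩′} t t′ → s T.~ᵀ t → s′ T′.~ᵀ t′
    ⇝-~ c d a = record
      { kinds = λ eq → T.kinds a (trans (⇝-kind φ c) (trans eq (sym (⇝-kind φ d))))
      ; agree = λ Y′∈ u∈ w∈ → let Y , Y∈ , m = preimage Y′∈ in
          conn-reflect (flip φ) (↦-flip φ m) (T.agree a Y∈ (dir-pull m c u∈) (dir-pull m d w∈))
      }

    part-push : ∀ {s s′ v} → _⇝_ φ {𝒩} {𝒩′} s s′ → v ∈ T.part s → to v ∈ T′.part s′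
    part-push c v∈ Y′∈ with preimage Y′∈
    ... | Y , Y∈ , m = map⊎ (push m) (dir-map φ m c) (v∈ Y∈)

    image-node : (∀ {X} → X ∈ 𝒩 → X Respects G._≈_) → (∀ {X X′} → _↦_ φ X X′ → X ∈ 𝒩 → X′ ∈ 𝒩′) →
      ∀ s → ∃[ s′ ] _⇝_ φ {𝒩} {𝒩′} s s′
    image-node 𝒩-resp forth (T.hub X X∈) = let m = ↦-image φ (𝒩-resp X∈) in
      T′.hub _ (forth m X∈) , hub m
    image-node 𝒩-resp forth (T.block X X∈ v v∉) = let m = ↦-image φ (𝒩-resp X∈) in
      T′.block _ (forth m X∈) (to v) (v∉ ∘ pull m) , block m (Setoid.refl G′.vertices)

  module _ {G G′ : Graph ℓ} (φ : G ≅ G′)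
    {𝒩 : Pred (Pred (Graph.V G) ℓ) (lsuc ℓ)} {𝒩′ : Pred (Pred (Graph.V G′) ℓ) (lsuc ℓ)}
    (𝒩-resp : ∀ {X} → X ∈ 𝒩 → X Respects Graph._≈_ G)
    (𝒩′-resp : ∀ {X} → X ∈ 𝒩′ → X Respects Graph._≈_ G′)
    (forth : ∀ {X X′} → _↦_ φ X X′ → X ∈ 𝒩 → X′ ∈ 𝒩′)
    (back : ∀ {X X′} → _↦_ (flip φ) X′ X → X′ ∈ 𝒩′ → X ∈ 𝒩) where
    private
      module G  = Graph G
      module G′ = Graph G′
      module T  = Nodes em G 𝒩
      module T′ = Nodes em G′ 𝒩′
      forth′ : ∀ {X X′} → _↦_ (flip (flip φ)) X X′ → X ∈ 𝒩 → X′ ∈ 𝒩′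
      forth′ m = forth (↦-unflip φ (↦-unflip (flip φ) m))
      toNode : ∀ s → ∃[ s′ ] _⇝_ φ {𝒩} {𝒩′} s s′
      toNode = image-node φ 𝒩′-resp back 𝒩-resp forth
      fromNode : ∀ s′ → ∃[ s ] _⇝_ (flip φ) {𝒩′} {𝒩} s′ s
      fromNode = image-node (flip φ) 𝒩-resp forth′ 𝒩′-resp back
      unflip : ∀ {s s′} → _⇝_ (flip φ) {𝒩′} {𝒩} s′ s → _⇝_ φ {𝒩} {𝒩′} s s′
      unflip (hub m) = hub (↦-unflip φ m)
      unflip (block m v≈v′) = block (↦-unflip φ m)
        (Setoid.trans G′.vertices (Inverse.to-cong inverse (Setoid.sym G.vertices v≈v′))
          (Inverse.strictlyInverseˡ inverse _))
        where open _≅_ φ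
      ⇝-≈′ : ∀ {s s′ t t′} → _⇝_ (flip φ) {𝒩′} {𝒩} s′ s → _⇝_ (flip φ) {𝒩′} {𝒩} t′ t → s′ T′.≈ᵀ t′ → s T.≈ᵀ t
      ⇝-≈′ = ⇝-≈ (flip φ) 𝒩-resp forth′
      flip-⇝ : ∀ {s s′} → _⇝_ φ {𝒩} {𝒩′} s s′ → _⇝_ (flip φ) {𝒩′} {𝒩} s′ s
      flip-⇝ = ⇝-flip φ 𝒩′-resp back

    tree-iso : T.tree ≅ T′.tree
    tree-iso = record
      { inverse = record
        { to        = λ s → proj₁ (toNode s)
        ; from      = λ s′ → proj₁ (fromNode s′)
        ; to-cong   = λ {s} {t} → ⇝-≈ φ 𝒩′-resp back (proj₂ (toNode s)) (proj₂ (toNode t))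
        ; from-cong = λ {s} {t} → ⇝-≈′ (proj₂ (fromNode s)) (proj₂ (fromNode t))
        ; inverse   = (λ {x} {y} e → ⇝-≈ φ 𝒩′-resp back (proj₂ (toNode y)) (unflip (proj₂ (fromNode x))) e)
                    , (λ {x} {y} e → ⇝-≈′ (proj₂ (fromNode y)) (flip-⇝ (proj₂ (toNode x))) e)
        }
      ; adjacent = λ {s} {t} → mk⇔
          (⇝-~ φ 𝒩′-resp back (proj₂ (toNode s)) (proj₂ (toNode t)))
          (⇝-~ (flip φ) 𝒩-resp forth′ (flip-⇝ (proj₂ (toNode s))) (flip-⇝ (proj₂ (toNode t))))
      }

    maps-part : ∀ s → MapsSet φ (T.part s) (T′.part (_≅_.to tree-iso s))
    maps-part s v = mk⇔ (part-push φ 𝒩′-resp back (proj₂ (toNode s)))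
      λ v∈ {Y} Y∈ → part-resp′ Y∈ (part-push (flip φ) 𝒩-resp forth′ (flip-⇝ (proj₂ (toNode s))) v∈ Y∈)
      where
      open _≅_ φ
      back-to-v : from (to v) G.≈ v
      back-to-v = Inverse.strictlyInverseʳ inverse v
      part-resp′ : ∀ {Y} → Y ∈ 𝒩 → from (to v) ∈ Y ⊎ from (to v) ∈ T.dir Y s → v ∈ Y ⊎ v ∈ T.dir Y s
      part-resp′ Y∈ = map⊎ (𝒩-resp Y∈ back-to-v) λ v∈ → T.dir-closed {s = s} v∈ (Separators.conn-≈ em G back-to-v)

-- The construction and its properties

module Construct (em : ∀ {a} → ExcludedMiddle a) {ℓ} (G : Graph ℓ) (𝒫 : Pred (Profile G) (lsuc ℓ)) (k : ℕ)
  (adm : Admissible G 𝒫 k) where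
  open Separators em G
  open Profiles em G 𝒫 k
  open Nodes em G 𝒩
  open Trees em G 𝒩 k (𝒩-tight adm) (optimal-nested adm) (𝒩-inhabited adm) public

  -- Some `X` in `𝒩` puts `P` and `P′` into different components. The edge from its hub to the block
  -- at a vertex where `P` lives induces `away`, which is in `P` and has its reverse in `P′`.
  distinguishes-profiles : ∀ {P P′} → P ∈ 𝒫 → P′ ∈ 𝒫 → Distinguishable k P P′ → TDDistinguishes decomposition P P′
  distinguishes-profiles P∈ P′∈ dist =
    let X , X∈ , s = 𝒩-distinguishes adm P∈ P′∈ dist
        tX = 𝒩-tight adm X∈
        v , live = lives adm P∈ (Tight.resp tX) (Tight.size tX)
        v′ , live′ = lives adm P′∈ (Tight.resp tX) (Tight.size tX)
        v∉X = Lives.∉separator live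
        b~ = block~hub X∈ v∉X
    in hub X X∈ , block X X∈ v v∉X , away (Tight.resp tX) v∉X ,
       (~ᵀ-sym b~ , away-side X∈ v∉X (hub-side X∈ b~) , big-side X∈ v∉X (block-side X∈ b~)) ,
       inj₁ (distinguish adm P∈ P′∈ tX live live′ (sep⇒apart adm s live live′))
    where
    module _ {X} (X∈ : X ∈ 𝒩) {v} (v∉X : v ∉ X) where
      b : Node
      b = block X X∈ v v∉X
      -- In direction `X` the block is seen only through `v`, so this direction is the component of
      -- `v`.
      toward : ∀ {w} → w ∈ dir X b → Conn X v w
      toward = dir-conn {s = b} X∈ (inj₂ (id , ε))
      away-side : ∀ {Side : Pred (Graph.V G) (lsuc ℓ)} → ∁ (dir X b) ≐ Side → (λ w → ¬ Conn X v w) ≐ Side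
      away-side (⊆Side , Side⊆) = (λ ¬vw → ⊆Side (¬vw ∘ toward)) , λ w∈ vw → Side⊆ w∈ (inj₂ (id , vw))
      big-side : ∀ {Side : Pred (Graph.V G) (lsuc ℓ)} → X ∪ dir X b ≐ Side → (λ w → w ∈ X ⊎ Conn X v w) ≐ Side
      big-side (⊆Side , Side⊆) = (λ { (inj₁ w∈X) → ⊆Side (inj₁ w∈X) ; (inj₂ vw) → ⊆Side (inj₂ (inj₂ (id , vw))) })
                               , λ w∈ → map⊎ id toward (Side⊆ w∈)

canonical : (em : ∀ {a} → ExcludedMiddle a) → ∀ {ℓ} → IsCanonical {ℓ} (Construct.decomposition em)
canonical em G 𝒫 k adm G′ 𝒫′ k′ adm′ φ onto
  -- Both numbers are the invariant `κ`, so they agree, and both sets `𝒩` are formed for the same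
  -- `k`.
  with refl ← Transport.κ-equal em φ onto (Admissible.k≡κ adm) (Admissible.k≡κ adm′) =
  tree-iso φ resp resp′ forth back , maps-part φ resp resp′ forth back
  where
  open Transport em
  resp : ∀ {X} → X ∈ Profiles.𝒩 em G 𝒫 k → X Respects Graph._≈_ G
  resp X∈ = Separators.Tight.resp (Profiles.𝒩-tight em G 𝒫 k adm X∈)
  resp′ : ∀ {X} → X ∈ Profiles.𝒩 em G′ 𝒫′ k → X Respects Graph._≈_ G′
  resp′ X∈ = Separators.Tight.resp (Profiles.𝒩-tight em G′ 𝒫′ k adm′ X∈)
  forth : ∀ {X X′} → _↦_ φ X X′ → X ∈ Profiles.𝒩 em G 𝒫 k → X′ ∈ Profiles.𝒩 em G′ 𝒫′ k
  forth = 𝒩-map φ onto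
  back : ∀ {X X′} → _↦_ (flip φ) X′ X → X′ ∈ Profiles.𝒩 em G′ 𝒫′ k → X ∈ Profiles.𝒩 em G 𝒫 k
  back = 𝒩-map (flip φ) (mapsOnto-flip φ onto)

theorem5p1 : (∀ {a} → ExcludedMiddle a) → ∀ {ℓ} →
    Σ[ 𝒯 ∈ Construction ℓ (lsuc ℓ) (lsuc ℓ) ]
    (∀ G 𝒫 k (adm : Admissible G 𝒫 k) {P P′} →
    P ∈ 𝒫 → P′ ∈ 𝒫 → IsRobust P → IsRobust P′ → Distinguishable k P P′ →
    TDDistinguishes (𝒯 G 𝒫 k adm) P P′)
    × IsCanonical 𝒯
    × (∀ G 𝒫 k (adm : Admissible G 𝒫 k) → IsBalanced (𝒯 G 𝒫 k adm) k)
theorem5p1 em =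
  Construct.decomposition em ,
  (λ G 𝒫 k adm P∈ P′∈ _ _ dist → Construct.distinguishes-profiles em G 𝒫 k adm P∈ P′∈ dist) ,
  canonical em ,
  λ G 𝒫 k adm → Construct.decomposition-balanced em G 𝒫 k adm
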